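{- Let $G$ be a unicyclic graph with $n \ge 4$ vertices and maximum degree $\Delta \ge 3$, let $q=\lfloor \frac{n}{\Delta-1}\rfloor$, and let $f : [1,\infty) \to \mathbb{R}$ be a concave function. If $q=1$ or $n=2\Delta-2$, then $$ I_f(G) \ge f(\Delta) + f(n-\Delta+1) + f(2) + (n-3) f(1). $$ If $q>1$ and $n\ne 2\Delta-2$, then $$ I_f(G) \ge q f(\Delta) + f\big(n-q(\Delta-1)+1\big) + (n-q-1) f(1). $$ The inequalities are attained (i.e., equality holds in the respective case) if and only if $G \in \mathcal{K}_n^\Delta$.
   Context: All graphs are finite, connected, simple (no loops, no multiple edges) and have at least one edge. A unicyclic graph is a graph containing exactly one cycle. For a vertex $u$ of $G$, $d_u$ denotes its degree. For a function $f:[1,\infty)\to\mathbb{R}$, $I_f(G) = \sum_{u\in V(G)} f(d_u)$. For $n\ge 4$, $3\le\Delta\le n-1$ and $q=\lfloor \frac{n}{\Delta-1}\rfloor$, define the $n$-tuple $\mathbf{z}$ as follows. If $q=1$ or $n=2\Delta-2$, then $\mathbf{z}=(\Delta,\,n-\Delta+1,\,2,\,1,\dots,1)$ with $n-3$ entries equal to $1$ at the end. If $q\ge 2$ and $n\ne 2\Delta-2$, then $\mathbf{z}=(z_1,\dots,z_n)$ with $z_j=\Delta$ for $1\le j\le q$, $z_{q+1}=n-q(\Delta-1)+1$, and $z_j=1$ for $q+1<j\le n$. $\mathcal{K}_n^\Delta$ is the set of unicyclic graphs with $n$ vertices whose degree sequence (in non-increasing order) is $\mathbf{z}$.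
   Formalization: For a constant or affine f equality holds for every unicyclic G, so "equality iff G ∈ K" is proved for each strictly concave f, and as "equality for all concave f iff G ∈ K"; the inequalities are proved for every concave f. -}

module Defs where

open import Algebra.Apartness.Bundles using (HeytingCommutativeRing; HeytingField)
open import Algebra.Bundles using (CommutativeRing)
import Algebra.Definitions.RawMonoid as RawMonoidDefs
open import Data.Fin.Base using (Fin)
open import Data.List.Base using (List; []; _∷_; _++_; _∷ʳ_; map; filter; length; replicate; allFin)
open import Data.List.Extrema.Nat using (max)
open import Data.List.Relation.Unary.Linked using (Linked)
open import Data.List.Relation.Unary.Unique.Propositional using (Unique)
import Data.List.Sort as Sort
open import Data.Nat.Base as ℕ using (ℕ; >-nonZero)
open import Data.Nat.DivMod using (_/_)
import Data.Nat.Properties as ℕ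
open import Data.Product.Base using (∃-syntax; Σ-syntax; _×_)
open import Data.Sum.Base using (_⊎_)
open import Function.Bundles using (_⇔_)
open import Level using (Level; _⊔_; suc; 0ℓ)
open import Relation.Binary.Construct.Closure.ReflexiveTransitive using (Star)
import Relation.Binary.Construct.Flip.EqAndOrd as Flip
open import Relation.Binary.Core using (Rel)
open import Relation.Binary.Definitions using (Decidable; Irreflexive; Symmetric)
open import Relation.Binary.PropositionalEquality.Core using (_≡_)
open import Relation.Binary.Structures using (IsStrictPartialOrder)
open import Relation.Nullary.Decidable.Core using (Dec; does; _⊎-dec_)
open import Relation.Nullary.Negation.Core using (¬_)
open import Data.Bool.Base using (if_then_else_)

------------------------------------------------------------------------
-- Graphs

record Graph (n : ℕ) : Set₁ where
  field
    Adj    : Rel (Fin n) 0ℓ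
    adj?   : Decidable Adj
    sym    : Symmetric Adj
    irrefl : Irreflexive _≡_ Adj

  degree : Fin n → ℕ
  degree u = length (filter (adj? u) (allFin n))

  degrees : List ℕ
  degrees = map degree (allFin n)

  maxDegree : ℕ
  maxDegree = max 0 degrees

  -- Sorting with respect to ≥ gives the non-increasing arrangement.
  degreeSequence : List ℕ
  degreeSequence = Sort.sort (Flip.decTotalOrder ℕ.≤-decTotalOrder) degrees

  Connected : Set
  Connected = ∀ u v → Star Adj u v

  -- The cycle  start - r₁ - … - rₖ - start  with k ≥ 2, where
  -- rest = r₁ ∷ … ∷ rₖ ∷ [].
  record Cycle : Set where
    field
      start : Fin n
      rest  : List (Fin n)

    closedWalk : List (Fin n)
    closedWalk = start ∷ rest ∷ʳ start

    field
      distinct : Unique (start ∷ rest)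
      long     : 2 ℕ.≤ length rest
      linked   : Linked Adj closedWalk

    _Precedes_ : Rel (Fin n) 0ℓ
    u Precedes v = ∃[ xs ] ∃[ ys ] closedWalk ≡ xs ++ u ∷ v ∷ ys

    Edge : Rel (Fin n) 0ℓ
    Edge u v = u Precedes v ⊎ v Precedes u

  -- Cycles are subgraphs: neither the base point nor the direction of
  -- travel matters, so they are compared by their edge sets.
  SameCycle : Rel Cycle 0ℓ
  SameCycle C D = ∀ u v → Cycle.Edge C u v ⇔ Cycle.Edge D u v

  -- Connectedness is part of the standing conventions on graphs.
  Unicyclic : Set
  Unicyclic = Connected × (Σ[ C ∈ Cycle ] (∀ D → SameCycle C D))

------------------------------------------------------------------------
-- The extremal degree sequence

quotient : (n Δ : ℕ) → 3 ℕ.≤ Δ → ℕ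
quotient n Δ 3≤Δ = _/_ n (Δ ℕ.∸ 1) {{>-nonZero (ℕ.m<n⇒0<n∸m (ℕ.≤-trans (ℕ.n≤1+n 2) 3≤Δ))}}

-- In the relevant range 3 ≤ Δ ≤ n - 1 no truncated subtraction below
-- underflows, and the negation of FirstCase amounts to q > 1 and
-- n ≢ 2Δ - 2, since q ≥ 1.
FirstCase : (n Δ : ℕ) → 3 ℕ.≤ Δ → Set
FirstCase n Δ 3≤Δ = quotient n Δ 3≤Δ ≡ 1 ⊎ n ≡ 2 ℕ.* Δ ℕ.∸ 2

firstCase? : (n Δ : ℕ) (3≤Δ : 3 ℕ.≤ Δ) → Dec (FirstCase n Δ 3≤Δ)
firstCase? n Δ 3≤Δ = (quotient n Δ 3≤Δ ℕ.≟ 1) ⊎-dec (n ℕ.≟ 2 ℕ.* Δ ℕ.∸ 2)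

𝐳 : (n Δ : ℕ) → 3 ℕ.≤ Δ → List ℕ
𝐳 n Δ 3≤Δ =
  if does (firstCase? n Δ 3≤Δ)
  then Δ ∷ n ℕ.∸ Δ ℕ.+ 1 ∷ 2 ∷ replicate (n ℕ.∸ 3) 1
  else replicate q Δ ++ (n ℕ.∸ q ℕ.* (Δ ℕ.∸ 1) ℕ.+ 1) ∷ replicate (n ℕ.∸ q ℕ.∸ 1) 1
  where
  q : ℕ
  q = quotient n Δ 3≤Δ

𝒦 : (n Δ : ℕ) → 3 ℕ.≤ Δ → Graph n → Set
𝒦 n Δ 3≤Δ G = Graph.Unicyclic G × Graph.degreeSequence G ≡ 𝐳 n Δ 3≤Δ

------------------------------------------------------------------------
-- Real numbers

-- Archimedean, Cauchy-complete ordered fields.  Classically ℝ is the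
-- only one up to isomorphism.  The order is given by _<_, without
-- assuming trichotomy, so that constructive models are also covered.
record RealNumbers (c ℓ₁ ℓ₂ : Level) : Set (suc (c ⊔ ℓ₁ ⊔ ℓ₂)) where
  infix 4 _<_ _≤_
  field
    heytingField : HeytingField c ℓ₁ ℓ₂

  open HeytingField heytingField public

  field
    _<_                  : Rel Carrier ℓ₂
    isStrictPartialOrder : IsStrictPartialOrder _≈_ _<_
    #⇔<⊎>                : ∀ x y → x # y ⇔ (x < y ⊎ y < x)
    +-monoˡ-<            : ∀ z {x y} → x < y → x + z < y + z
    *-pos                : ∀ {x y} → 0# < x → 0# < y → 0# < x * y

  _≤_ : Rel Carrier ℓ₂
  x ≤ y = ¬ (y < x)

  commutativeRing : CommutativeRing c ℓ₁
  commutativeRing = HeytingCommutativeRing.commutativeRing heytingCommutativeRing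

  open RawMonoidDefs (CommutativeRing.+-rawMonoid commutativeRing) public
    using (sum) renaming (_×_ to _·_)

  fromℕ : ℕ → Carrier
  fromℕ m = m · 1#

  IsCauchy : (ℕ → Carrier) → Set (c ⊔ ℓ₂)
  IsCauchy s = ∀ ε → 0# < ε →
    ∃[ N ] (∀ i j → N ℕ.≤ i → N ℕ.≤ j → s i - s j < ε)

  _ConvergesTo_ : (ℕ → Carrier) → Carrier → Set (c ⊔ ℓ₂)
  s ConvergesTo x = ∀ ε → 0# < ε →
    ∃[ N ] (∀ i → N ℕ.≤ i → (s i - x < ε) × (x - s i < ε))

  field
    archimedean : ∀ x → ∃[ m ] x < fromℕ m
    complete    : ∀ s → IsCauchy s → ∃[ x ] (s ConvergesTo x)

------------------------------------------------------------------------
-- Concave functions on [1,∞) and the index I_f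

module OverReals {c ℓ₁ ℓ₂ : Level} (ℝ : RealNumbers c ℓ₁ ℓ₂) where

  open RealNumbers ℝ

  -- A function [1,∞) → ℝ is represented by an operation f on the carrier
  -- whose behaviour outside [1,∞) is unconstrained; even compatibility
  -- with _≈_ is only required on [1,∞).
  record IsConcave (f : Carrier → Carrier) : Set (c ⊔ ℓ₁ ⊔ ℓ₂) where
    field
      cong    : ∀ {x y} → 1# ≤ x → 1# ≤ y → x ≈ y → f x ≈ f y
      concave : ∀ x y t → 1# ≤ x → 1# ≤ y → 0# ≤ t → t ≤ 1# →
                t * f x + (1# - t) * f y ≤ f (t * x + (1# - t) * y)

  record IsStrictlyConcave (f : Carrier → Carrier) : Set (c ⊔ ℓ₁ ⊔ ℓ₂) where
    field
      isConcave : IsConcave f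
      strict    : ∀ x y t → 1# ≤ x → 1# ≤ y → x # y → 0# < t → t < 1# →
                  t * f x + (1# - t) * f y < f (t * x + (1# - t) * y)

  I : ∀ {n} → (Carrier → Carrier) → Graph n → Carrier
  I f G = sum (λ u → f (fromℕ (Graph.degree G u)))

  open RealNumbers ℝ public
    using (Carrier; 1#; fromℕ)
    renaming (_≈_ to _≈ᴿ_; _≤_ to _≤ᴿ_; _+_ to _+ᴿ_; _*_ to _*ᴿ_)

{-# OPTIONS --safe #-}
module Submission where

open import Defs
open import Algebra.Bundles using (CommutativeRing)
import Algebra.Solver.Ring.NaturalCoefficients.Default as NaturalCoefficients
open import Data.Empty using (⊥-elim)
open import Data.Fin.Base as Fin using (Fin)
import Data.Fin.Properties as Fin
import Data.List.Extrema.Nat as Extrema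
open import Data.List.Base using (List; []; _∷_; _++_; _∷ʳ_; map; filter; length; replicate; tabulate; allFin; cartesianProduct)
open import Data.List.Membership.Propositional using (_∈_)
open import Data.List.Membership.Propositional.Properties
  using (∈-∃++; ∈-map⁺; ∈-map⁻; ∈-filter⁺; ∈-filter⁻; ∈-cartesianProduct⁺; ∈-allFin; ∈-length)
open import Data.List.Membership.Propositional.Properties.WithK using (unique∧set⇒bag)
import Data.List.Properties as List
open import Data.List.Relation.Binary.BagAndSetEquality using (∼bag⇒↭)
open import Data.List.Relation.Binary.Permutation.Propositional as Permutation
  using (_↭_; ↭-refl; ↭-sym; ↭-trans; ↭-reflexive; prep; swap; ↭⇒↭ₛ)
open import Data.List.Relation.Binary.Permutation.Propositional.Properties
  using (∈-resp-↭; All-resp-↭; ↭-length; shift; map⁺; ++⁺ˡ)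
import Data.List.Relation.Binary.Permutation.Setoid.Properties as PermutationSetoid
import Data.List.Relation.Binary.Pointwise as Pointwise
open import Data.List.Relation.Unary.All as All using (All; []; _∷_)
import Data.List.Relation.Unary.All.Properties as All
open import Data.List.Relation.Unary.AllPairs using ([]; _∷_)
open import Data.List.Relation.Unary.Any using (here; there)
open import Data.List.Relation.Unary.Linked as Linked using (Linked; [-]; _∷_)
open import Data.List.Relation.Unary.Sorted.TotalOrder.Properties using (↗↭↗⇒≋)
open import Data.List.Relation.Unary.Unique.Propositional using (Unique)
import Data.List.Relation.Unary.Unique.Propositional.Properties as Unique
import Data.List.Sort as Sort
open import Data.Nat using (ℕ; zero; suc; pred; _+_; _*_; _∸_; _≤_; _<_; _≥_; _>_; s≤s; z≤n; NonZero; >-nonZero)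
open import Data.Nat.Divisibility using (n∣m*n)
open import Data.Nat.DivMod using (_/_; _%_; +-distrib-/-∣ʳ; m<n⇒m/n≡0; m*n/n≡m; m≡m%n+[m/n]*n; m%n<n)
open import Data.Nat.ListAction using (sum)
open import Data.Nat.ListAction.Properties using (sum-↭)
import Data.Nat.Properties as ℕ
open import Data.Nat.Tactic.RingSolver using (solve-∀)
open import Data.Product using (Σ-syntax; ∃-syntax; ∃₂; _×_; _,_; proj₁; proj₂)
import Data.Product as Product
open import Data.Product.Properties using (≡-dec)
open import Data.Sum as Sum using (_⊎_; inj₁; inj₂; [_,_]′)
open import Function.Base using (_∘_; id)
open import Function.Bundles using (_⇔_; mk⇔; Equivalence)
open import Level using (Level; 0ℓ)
open import Relation.Binary.Bundles using (DecTotalOrder)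
open import Relation.Binary.Construct.Closure.ReflexiveTransitive as Star using (Star; ε; _◅_; _◅◅_; reverse)
import Relation.Binary.Construct.Flip.EqAndOrd as Flip
open import Relation.Binary.Core using (Rel)
open import Relation.Binary.Definitions using (DecidableEquality; tri<; tri≈; tri>)
open import Relation.Binary.PropositionalEquality
  using (_≡_; _≢_; refl; sym; trans; cong; cong₂; subst; subst₂; setoid; module ≡-Reasoning)
open import Relation.Binary.Structures using (IsStrictPartialOrder)
open import Relation.Nullary using (¬_; Dec; yes; no; ¬?)
open import Relation.Nullary.Decidable using (dec-true; dec-false)

-- Listing the edges of a graph one by one, an edge either joins two components
-- or closes a cycle with earlier edges. If the list consists of all edges but
-- one edge of the only cycle, no edge closes a cycle; so a unicyclic graph with
-- n vertices has n edges, and the excesses deg u − 1 add up to n.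
--
-- By concavity, moving two excesses apart while keeping their sum does not
-- increase I_f, and decreases it if f is strictly concave. Excesses bounded by
-- Δ − 1 can be moved apart until all but one are 0 or Δ − 1. If n ≤ 2Δ − 2, the
-- resulting sequence is not attained, since at least three excesses (those on
-- the cycle) are positive; then an excess Δ − 1 is kept, and the others, of
-- which two are positive, are gathered into n − Δ, 1, 0, …, 0.

-- Counting the edges of a unicyclic graph

private
  variable
    A : Set
    v w : A
    xs ys zs : List A

  module Permutationₛ {A : Set} = PermutationSetoid (setoid A)

∈⇒↭ : v ∈ xs → ∃[ ys ] xs ↭ v ∷ ys
∈⇒↭ {v = v} v∈xs with ys , zs , refl ← ∈-∃++ v∈xs = ys ++ zs , shift v ys zs

Unique-resp-↭ : xs ↭ ys → Unique xs → Unique ys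
Unique-resp-↭ = Permutationₛ.Unique-resp-↭ ∘ ↭⇒↭ₛ

∈-tail : v ∈ w ∷ xs → v ≢ w → v ∈ xs
∈-tail (here v≡w) v≢w = ⊥-elim (v≢w v≡w)
∈-tail (there v∈xs) _ = v∈xs

-- Walks, simple paths and closed walks.

data Path (R : Rel A 0ℓ) : A → List A → A → Set where
  []  : Path R v [] v
  _∷_ : ∀ {z} → R v w → Path R w xs z → Path R v (w ∷ xs) z

Path-map : ∀ {R S : Rel A 0ℓ} → (∀ {x y} → R x y → S x y) → Path R v xs w → Path S v xs w
Path-map f [] = []
Path-map f (r ∷ p) = f r ∷ Path-map f p

module _ {R : Rel A 0ℓ} where

  suffix : ∀ {u w v} → u ∈ w ∷ xs → Path R w xs v → Unique (w ∷ xs) →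
           ∃[ ys ] Path R u ys v × Unique (u ∷ ys)
  suffix (here refl) p uniq = _ , p , uniq
  suffix (there u∈) (_ ∷ p) (_ ∷ uniq) = suffix u∈ p uniq

  -- Loop erasure: when the new start already lies on the simple path built so far, that path is cut
  -- at this vertex by `suffix` instead of being prolonged.
  simplePath : DecidableEquality A → ∀ {u v} → Star R u v → ∃[ xs ] Path R u xs v × Unique (u ∷ xs)
  simplePath _≟_ ε = [] , [] , [] ∷ []
  simplePath _≟_ {u} (_◅_ {j = w} r s) with simplePath _≟_ s
  ... | xs , p , uniq with u ∈? (w ∷ xs)
    where open import Data.List.Membership.DecPropositional _≟_ using (_∈?_)
  ...   | yes u∈ = suffix u∈ p uniq
  ...   | no u∉  = w ∷ xs , r ∷ p , All.¬Any⇒All¬ _ u∉ ∷ uniq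

  close : ∀ {u v w} → Path R u xs v → R v w → Linked R (u ∷ xs ∷ʳ w)
  close [] r = r ∷ [-]
  close (q ∷ p) r = q ∷ close p r

  consecutive : ∀ xs {u v ys} → Linked R (xs ++ u ∷ v ∷ ys) → R u v
  consecutive [] (r ∷ _) = r
  consecutive (x ∷ []) (_ ∷ l) = consecutive [] l
  consecutive (x ∷ y ∷ xs) (_ ∷ l) = consecutive (y ∷ xs) l

  penultimate : ∀ x xs {z} → Linked R (x ∷ xs ∷ʳ z) → ∃[ y ] y ∈ x ∷ xs × R y z
  penultimate x [] (r ∷ _) = x , here refl , r
  penultimate x (y ∷ xs) (_ ∷ l) with penultimate y xs l
  ... | w , w∈ , r = w , there w∈ , r

-- Forests grown edge by edge.

module _ {n : ℕ} where

  private
    V : Set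
    V = Fin n

  -- An edge is stored once, as an ascending pair, so both orientations have to be looked up.
  Link : List (V × V) → Rel V 0ℓ
  Link es u v = (u , v) ∈ es ⊎ (v , u) ∈ es

  Ascending : V × V → Set
  Ascending (u , v) = u Fin.< v

  -- Mirrors the fields of `Cycle` for an arbitrary relation, so that cycles inside a partial list
  -- of edges can be expressed.
  ClosedPath : Rel V 0ℓ → Set
  ClosedPath R = Σ[ u ∈ V ] Σ[ xs ∈ List V ]
    Unique (u ∷ xs) × 2 ≤ length xs × Linked R (u ∷ xs ∷ʳ u)

  Link-mono : ∀ {e es u v} → Link es u v → Link (e ∷ es) u v
  Link-mono = Sum.map there there

  -- Each edge has a single entry: a second copy would violate uniqueness, and the reversed pair
  -- would not be ascending.
  removed⇒unlinked : ∀ {e es s r} → Unique (e ∷ es) → All Ascending (e ∷ es) →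
                     e ≡ (s , r) ⊎ e ≡ (r , s) → ¬ Link es s r
  removed⇒unlinked uniq _ (inj₁ refl) (inj₁ sr∈) = Unique.Unique[x∷xs]⇒x∉xs uniq sr∈
  removed⇒unlinked _ (s<r ∷ asc) (inj₁ refl) (inj₂ rs∈) = ℕ.<-asym s<r (All.lookup asc rs∈)
  removed⇒unlinked _ (r<s ∷ asc) (inj₂ refl) (inj₁ sr∈) = ℕ.<-asym r<s (All.lookup asc sr∈)
  removed⇒unlinked uniq _ (inj₂ refl) (inj₂ rs∈) = Unique.Unique[x∷xs]⇒x∉xs uniq rs∈

  -- The state of a union-find run, where `rep` names the component of a vertex. Acyclicity is
  -- recorded through `count`: every edge has lowered the number of components by one.
  record Forest (es : List (V × V)) : Set where
    field
      rep   : V → V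
      roots : List V
      roots-unique : Unique roots
      rep∈roots    : ∀ v → rep v ∈ roots
      rep-root     : ∀ {u} → u ∈ roots → rep u ≡ u
      toRep        : ∀ v → Star (Link es) v (rep v)
      rep-resp     : ∀ {u v} → Link es u v → rep u ≡ rep v
      count        : length es + length roots ≡ n

  noEdges : Forest []
  noEdges = record
    { rep = λ v → v
    ; roots = allFin n
    ; roots-unique = Unique.allFin⁺ n
    ; rep∈roots = ∈-allFin
    ; rep-root = λ _ → refl
    ; toRep = λ _ → ε
    ; rep-resp = λ { (inj₁ ()) ; (inj₂ ()) }
    ; count = List.length-tabulate {n = n} (λ v → v)
    }

  -- The component of `v` is redirected to the representative of `u`, and `rep v` ceases to be a
  -- root; one edge more and one root less preserve `count`.
  merge : ∀ {es u v} (F : Forest es) → Forest.rep F u ≢ Forest.rep F v → Forest ((u , v) ∷ es)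
  merge {es} {u} {v} F a≢b with ∈⇒↭ (Forest.rep∈roots F v)
  ... | roots′ , p = record
    { rep = redirect ∘ rep
    ; roots = roots′
    ; roots-unique = roots′-unique
    ; rep∈roots = rep′∈
    ; rep-root = rep′-root
    ; toRep = toRep′
    ; rep-resp = rep′-resp
    ; count = trans (sym (ℕ.+-suc (length es) _)) (trans (cong (length es +_) (sym (↭-length p))) count)
    }
    where
    open Forest F

    unique′ : Unique (rep v ∷ roots′)
    unique′ = Unique-resp-↭ p roots-unique

    roots′-unique : Unique roots′
    roots′-unique with _ ∷ uniq ← unique′ = uniq

    redirect : V → V
    redirect w with w Fin.≟ rep v
    ... | yes _ = rep u
    ... | no _  = w

    redirect-no : ∀ {w} → w ≢ rep v → redirect w ≡ w
    redirect-no {w} w≢ with w Fin.≟ rep v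
    ... | yes w≡ = ⊥-elim (w≢ w≡)
    ... | no _   = refl

    redirect-yes : redirect (rep v) ≡ rep u
    redirect-yes with rep v Fin.≟ rep v
    ... | yes _ = refl
    ... | no ≢  = ⊥-elim (≢ refl)

    rep′∈ : ∀ w → redirect (rep w) ∈ roots′
    rep′∈ w with rep w Fin.≟ rep v
    ... | yes _ = ∈-tail (∈-resp-↭ p (rep∈roots u)) a≢b
    ... | no w≢ = ∈-tail (∈-resp-↭ p (rep∈roots w)) w≢

    rep′-root : ∀ {w} → w ∈ roots′ → redirect (rep w) ≡ w
    rep′-root {w} w∈ rewrite rep-root (∈-resp-↭ (↭-sym p) (there w∈)) =
      redirect-no λ { refl → Unique.Unique[x∷xs]⇒x∉xs unique′ w∈ }

    old : ∀ {x y} → Star (Link es) x y → Star (Link ((u , v) ∷ es)) x y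
    old = Star.map Link-mono

    toRep′ : ∀ w → Star (Link ((u , v) ∷ es)) w (redirect (rep w))
    toRep′ w with rep w Fin.≟ rep v
    ... | yes w≡ = old (subst (Star _ w) w≡ (toRep w) ◅◅ reverse Sum.swap (toRep v))
                   ◅◅ (inj₂ (here refl) ◅ old (toRep u))
    ... | no _ = old (toRep w)

    joined : redirect (rep u) ≡ redirect (rep v)
    joined = trans (redirect-no a≢b) (sym redirect-yes)

    rep′-resp : ∀ {x y} → Link ((u , v) ∷ es) x y → redirect (rep x) ≡ redirect (rep y)
    rep′-resp (inj₁ (here refl)) = joined
    rep′-resp (inj₂ (here refl)) = sym joined
    rep′-resp (inj₁ (there q)) = cong redirect (rep-resp (inj₁ q))
    rep′-resp (inj₂ (there q)) = cong redirect (rep-resp (inj₂ q))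

  -- An edge whose ends have different representatives joins two trees. If the representatives
  -- agree, the earlier edges connect the ends through the common representative, and the new edge
  -- closes a simple path between them.
  forestOrCycle : ∀ es → Unique es → All Ascending es → ClosedPath (Link es) ⊎ Forest es
  forestOrCycle [] _ _ = inj₂ noEdges
  forestOrCycle ((u , v) ∷ es) uniq₀@(_ ∷ uniq) (u<v ∷ asc) with forestOrCycle es uniq asc
  ... | inj₁ (w , xs , distinct , long , linked) =
    inj₁ (w , xs , distinct , long , Linked.map Link-mono linked)
  ... | inj₂ F with Forest.rep F u Fin.≟ Forest.rep F v
  ...   | no ≢ = inj₂ (merge F ≢)
  ...   | yes eq with simplePath Fin._≟_ (subst (Star _ u) eq (Forest.toRep F u)
                                          ◅◅ reverse Sum.swap (Forest.toRep F v))
  -- A simple path with fewer than two edges would make the new edge a loop or a repetition of an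
  -- earlier one.
  ...     | [] , [] , _ = ⊥-elim (ℕ.<-irrefl refl u<v)
  ...     | _ ∷ [] , inj₁ uv∈ ∷ [] , _ = ⊥-elim (Unique.Unique[x∷xs]⇒x∉xs uniq₀ uv∈)
  ...     | _ ∷ [] , inj₂ vu∈ ∷ [] , _ = ⊥-elim (ℕ.<-asym u<v (All.lookup asc vu∈))
  ...     | xs@(_ ∷ _ ∷ _) , p , distinct =
    inj₁ (u , xs , distinct , s≤s (s≤s z≤n) , close (Path-map Link-mono p) (inj₂ (here refl)))

  allRepsEqual : ∀ {es} (F : Forest es) → ∀ {u v} → Star (Link es) u v → Forest.rep F u ≡ Forest.rep F v
  allRepsEqual F ε = refl
  allRepsEqual F (r ◅ s) = trans (Forest.rep-resp F r) (allRepsEqual F s)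

  -- Representatives agree along walks and a root represents itself, so connectedness allows one
  -- root only; the given vertex ensures that there is one.
  spanningTree : ∀ {es} → Forest es → V → (∀ u v → Star (Link es) u v) → length es + 1 ≡ n
  spanningTree {es} F v conn = trans (cong (length es +_) (sym one)) count
    where
    open Forest F
    one : length roots ≡ 1
    one with roots in eq | rep∈roots v
    ... | _ ∷ [] | _ = refl
    ... | x ∷ y ∷ _ | _ = ⊥-elim (Unique.Unique[x∷xs]⇒x∉xs (subst Unique eq roots-unique) (here x≡y))
      where
      x≡y : x ≡ y
      x≡y = trans (sym (rep-root (subst (x ∈_) (sym eq) (here refl))))
           (trans (allRepsEqual F (conn x y)) (rep-root (subst (y ∈_) (sym eq) (there (here refl)))))

-- Edges and degrees of a graph.

module _ {n : ℕ} (G : Graph n) where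
  open Graph G renaming (sym to Adj-sym)

  private
    V : Set
    V = Fin n

    adjPair? : ∀ (e : V × V) → Dec (Adj (proj₁ e) (proj₂ e))
    adjPair? (u , v) = adj? u v

    ascending? : ∀ (e : V × V) → Dec (Ascending e)
    ascending? (u , v) = u Fin.<? v

  arcs edges : List (V × V)
  arcs  = filter adjPair? (cartesianProduct (allFin n) (allFin n))
  edges = filter ascending? arcs

  private
    arcs-unique : Unique arcs
    arcs-unique = Unique.filter⁺ adjPair? (Unique.cartesianProduct⁺ (Unique.allFin⁺ n) (Unique.allFin⁺ n))

    ∈-arcs⁺ : ∀ {u v} → Adj u v → (u , v) ∈ arcs
    ∈-arcs⁺ {u} {v} = ∈-filter⁺ adjPair? (∈-cartesianProduct⁺ (∈-allFin u) (∈-allFin v))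

    ∈-arcs⁻ : ∀ {u v} → (u , v) ∈ arcs → Adj u v
    ∈-arcs⁻ = proj₂ ∘ ∈-filter⁻ adjPair? {xs = cartesianProduct (allFin n) (allFin n)}

  edges-unique : Unique edges
  edges-unique = Unique.filter⁺ ascending? arcs-unique

  edges-ascending : All Ascending edges
  edges-ascending = All.all-filter ascending? arcs

  Link-edges⁺ : ∀ {u v} → Adj u v → Link edges u v
  Link-edges⁺ {u} {v} uv with Fin.<-cmp u v
  ... | tri< u<v _ _ = inj₁ (∈-filter⁺ ascending? (∈-arcs⁺ uv) u<v)
  ... | tri≈ _ u≡v _ = ⊥-elim (irrefl u≡v uv)
  ... | tri> _ _ v<u = inj₂ (∈-filter⁺ ascending? (∈-arcs⁺ (Adj-sym uv)) v<u)

  Link-edges⁻ : ∀ {u v} → Link edges u v → Adj u v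
  Link-edges⁻ (inj₁ uv∈) = ∈-arcs⁻ (proj₁ (∈-filter⁻ ascending? uv∈))
  Link-edges⁻ (inj₂ vu∈) = Adj-sym (∈-arcs⁻ (proj₁ (∈-filter⁻ ascending? vu∈)))

  private
    descending : List (V × V)
    descending = filter (¬? ∘ ascending?) arcs

    -- Reversal matches the arcs of the two orientations, and duplicate-free lists with the same
    -- members are permutations of each other.
    descending∼edges : length descending ≡ length edges
    descending∼edges = trans
      (↭-length (∼bag⇒↭ (unique∧set⇒bag (Unique.filter⁺ (¬? ∘ ascending?) arcs-unique)
        (Unique.map⁺ (λ { refl → refl }) edges-unique) (mk⇔ to from))))
      (List.length-map Product.swap edges)
      where
      to : ∀ {e} → e ∈ descending → e ∈ map Product.swap edges
      to {u , v} e∈ with ∈-filter⁻ (¬? ∘ ascending?) e∈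
      ... | e∈arcs , ≮ with Link-edges⁺ (∈-arcs⁻ e∈arcs)
      ...   | inj₁ uv∈ = ⊥-elim (≮ (All.lookup edges-ascending uv∈))
      ...   | inj₂ vu∈ = ∈-map⁺ Product.swap vu∈
      from : ∀ {e} → e ∈ map Product.swap edges → e ∈ descending
      from e∈ with ∈-map⁻ Product.swap e∈
      ... | (u , v) , uv∈ , refl = ∈-filter⁺ (¬? ∘ ascending?) (∈-arcs⁺ (Link-edges⁻ (inj₂ uv∈)))
                                     (ℕ.<-asym (All.lookup edges-ascending uv∈))

    length-filter-¬ : ∀ {P : V × V → Set} (P? : ∀ e → Dec (P e)) es →
                      length es ≡ length (filter P? es) + length (filter (¬? ∘ P?) es)
    length-filter-¬ P? [] = refl
    length-filter-¬ P? (e ∷ es) with P? e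
    ... | yes _ = cong suc (length-filter-¬ P? es)
    ... | no _  = trans (cong suc (length-filter-¬ P? es)) (sym (ℕ.+-suc (length (filter P? es)) _))

    length-arcs : ∀ us → length (filter adjPair? (cartesianProduct us (allFin n))) ≡ sum (map degree us)
    length-arcs [] = refl
    length-arcs (u ∷ us) = begin
      length (filter adjPair? (map (u ,_) (allFin n) ++ cartesianProduct us (allFin n)))
        ≡⟨ cong length (List.filter-++ adjPair? (map (u ,_) (allFin n)) _) ⟩
      length (filter adjPair? (map (u ,_) (allFin n)) ++ filter adjPair? (cartesianProduct us (allFin n)))
        ≡⟨ List.length-++ (filter adjPair? (map (u ,_) (allFin n))) ⟩
      length (filter adjPair? (map (u ,_) (allFin n))) + length (filter adjPair? (cartesianProduct us (allFin n)))
        ≡⟨ cong₂ _+_ (row (allFin n)) (length-arcs us) ⟩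
      degree u + sum (map degree us) ∎
      where
      open ≡-Reasoning
      row : ∀ vs → length (filter adjPair? (map (u ,_) vs)) ≡ length (filter (adj? u) vs)
      row [] = refl
      row (v ∷ vs) with adj? u v
      ... | yes _ = cong suc (row vs)
      ... | no _  = row vs

  -- The arcs are counted in two ways: by their tails, which gives the degrees, and by orientation,
  -- where each edge appears once in either class.
  handshake : sum degrees ≡ length edges + length edges
  handshake = trans (sym (length-arcs (allFin n)))
    (trans (length-filter-¬ ascending? arcs) (cong (length edges +_) descending∼edges))

  -- Remove the edge `s r` of the only cycle. A cycle among the other edges would be a cycle of the
  -- graph, hence the same one, and would use the missing edge. So a forest remains. The rest of the
  -- cycle is a detour around the gap, so this forest is connected and has n - 1 edges.
  edgeCount : Unicyclic → length edges ≡ n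
  edgeCount (_ , record { rest = r ∷ [] ; long = s≤s () } , _)
  edgeCount (connected , C@record
    { start = s ; rest = r ∷ r₂ ∷ rs
    ; distinct = (s≢r ∷ s≢r₂ ∷ s∉rs) ∷ (r≢r₂ ∷ r∉rs) ∷ _
    ; linked = sr ∷ rr₂ ∷ linked′ } , only) =
    edgeCount′ (removed (Link-edges⁺ sr))
    where
    removed : Link edges s r → ∃₂ λ e es → edges ↭ e ∷ es × (e ≡ (s , r) ⊎ e ≡ (r , s))
    removed (inj₁ e∈) = _ , _ , proj₂ (∈⇒↭ e∈) , inj₁ refl
    removed (inj₂ e∈) = _ , _ , proj₂ (∈⇒↭ e∈) , inj₂ refl

    edgeCount′ : (∃₂ λ e es → edges ↭ e ∷ es × (e ≡ (s , r) ⊎ e ≡ (r , s))) → length edges ≡ n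
    edgeCount′ (e , es , p , e≡) with Unique-resp-↭ p edges-unique | All-resp-↭ p edges-ascending
    ... | uniq₀@(_ ∷ uniq) | asc₀@(_ ∷ asc) with forestOrCycle es uniq asc
    ...   | inj₁ (u , xs , distinct , long , linked) = ⊥-elim (removed⇒unlinked uniq₀ asc₀ e≡ D-edge)
      where
      D : Cycle
      D = record { start = u ; rest = xs ; distinct = distinct ; long = long
                 ; linked = Linked.map (Link-edges⁻ ∘ Sum.map back back) linked }
        where
        back : ∀ {f} → f ∈ es → f ∈ edges
        back = ∈-resp-↭ (↭-sym p) ∘ there
      D-edge : Link es s r
      -- `s` and `r` are the first two vertices of the closed walk of `C`; uniqueness carries this
      -- edge over to `D`.
      D-edge with Equivalence.to (only D s r) (inj₁ ([] , _ , refl))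
      ... | inj₁ (ys , zs , eq) = consecutive ys (subst (Linked (Link es)) eq linked)
      ... | inj₂ (ys , zs , eq) = Sum.swap (consecutive ys (subst (Linked (Link es)) eq linked))
    ...   | inj₂ F = trans (↭-length p) (trans (ℕ.+-comm 1 (length es)) (spanningTree F s conn))
      where
      ∈es : ∀ {f} → f ∈ edges → f ≢ (s , r) → f ≢ (r , s) → f ∈ es
      ∈es f∈ ≢sr ≢rs = ∈-tail (∈-resp-↭ p f∈) λ f≡e → [ ≢sr ∘ trans f≡e , ≢rs ∘ trans f≡e ]′ e≡

      survives : ∀ {x y} → ¬ (x ≡ s × y ≡ r) → ¬ (x ≡ r × y ≡ s) → Adj x y → Link es x y
      survives ≢sr ≢rs xy = Sum.map
        (λ q → ∈es q (λ { refl → ≢sr (refl , refl) }) (λ { refl → ≢rs (refl , refl) }))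
        (λ q → ∈es q (λ { refl → ≢rs (refl , refl) }) (λ { refl → ≢sr (refl , refl) }))
        (Link-edges⁺ xy)

      -- From `r₂` on, every step starts at a vertex other than `s` and `r`, so it is not the
      -- removed edge in either direction.
      around : ∀ {x} xs → s ≢ x → r ≢ x → All (s ≢_) xs → All (r ≢_) xs →
               Linked Adj (x ∷ xs ∷ʳ s) → Star (Link es) x s
      around [] s≢x r≢x _ _ (xs ∷ _) = survives (s≢x ∘ sym ∘ proj₁) (r≢x ∘ sym ∘ proj₁) xs ◅ ε
      around (y ∷ ys) s≢x r≢x (s≢y ∷ s∉) (r≢y ∷ r∉) (xy ∷ l) =
        survives (s≢x ∘ sym ∘ proj₁) (r≢x ∘ sym ∘ proj₁) xy ◅ around ys s≢y r≢y s∉ r∉ l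

      detour : Star (Link es) r s
      detour = survives (s≢r ∘ sym ∘ proj₁) (s≢r₂ ∘ sym ∘ proj₂) rr₂ ◅ around rs s≢r₂ r≢r₂ s∉rs r∉rs linked′

      step : ∀ {x y} → Adj x y → Star (Link es) x y
      step {x} {y} xy with ≡-dec Fin._≟_ Fin._≟_ (x , y) (s , r) | ≡-dec Fin._≟_ Fin._≟_ (x , y) (r , s)
      ... | yes refl | _ = reverse Sum.swap detour
      ... | no _ | yes refl = detour
      ... | no ≢sr | no ≢rs =
        survives (λ { (refl , refl) → ≢sr refl }) (λ { (refl , refl) → ≢rs refl }) xy ◅ ε

      conn : ∀ u v → Star (Link es) u v
      conn u v = Star.concat (Star.map step (connected u v))

  sum-degrees : Unicyclic → sum degrees ≡ n + n
  sum-degrees unicyclic = trans handshake (cong (λ m → m + m) (edgeCount unicyclic))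

  private
    ∈-neighbours : ∀ {u v} → Adj u v → v ∈ filter (adj? u) (allFin n)
    ∈-neighbours {u} {v} = ∈-filter⁺ (adj? u) (∈-allFin v)

  -- The cycle provides a second vertex, and a walk to it has a first edge at `u`.
  0<degree : Unicyclic → ∀ u → 0 < degree u
  0<degree (connected , C , _) u with otherVertex C
    where
    otherVertex : Cycle → ∃[ v ] u ≢ v
    otherVertex record { rest = [] ; long = () }
    otherVertex record { start = s ; rest = r ∷ _ ; distinct = (s≢r ∷ _) ∷ _ } with u Fin.≟ s
    ... | yes refl = r , s≢r
    ... | no u≢s   = s , u≢s
  ... | v , u≢v with connected u v
  ...   | ε = ⊥-elim (u≢v refl)
  ...   | uw ◅ _ = ∈-length (∈-neighbours uw)

  1<degree : ∀ {u v w} → v ≢ w → Adj u v → Adj u w → 1 < degree u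
  1<degree v≢w uv uw with ∈⇒↭ (∈-neighbours uv)
  ... | ys , p = subst (1 <_) (sym (↭-length p))
    (s≤s (∈-length (∈-tail (∈-resp-↭ p (∈-neighbours uw)) (v≢w ∘ sym))))

  -- The first three vertices of the cycle serve, each having two distinct neighbours on it.
  threeBranching : Cycle → ∃[ us ] length us ≡ 3 × Unique us × All (λ u → 1 < degree u) us
  threeBranching record { rest = r ∷ [] ; long = s≤s () }
  threeBranching record
    { start = s ; rest = r ∷ r₂ ∷ rs
    ; distinct = (s≢r ∷ s≢r₂ ∷ _) ∷ (r≢r₂ ∷ r∉rs) ∷ _
    ; linked = sr ∷ rr₂ ∷ l } =
    s ∷ r ∷ r₂ ∷ [] , refl , (s≢r ∷ s≢r₂ ∷ []) ∷ (r≢r₂ ∷ []) ∷ [] ∷ [] ,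
    degree-s ∷ 1<degree s≢r₂ (Adj-sym sr) rr₂ ∷ degree-r₂ rs r∉rs l ∷ []
    where
    -- The second neighbour of `s` is the last vertex of the cycle, which may be `r₂` but not `r`.
    degree-s : 1 < degree s
    degree-s with penultimate r₂ rs l
    ... | y , y∈ , ys = 1<degree (All.lookup (r≢r₂ ∷ r∉rs) y∈) sr (Adj-sym ys)
    degree-r₂ : ∀ rs → All (r ≢_) rs → Linked Adj (r₂ ∷ rs ∷ʳ s) → 1 < degree r₂
    degree-r₂ [] _ (r₂s ∷ _) = 1<degree (s≢r ∘ sym) (Adj-sym rr₂) r₂s
    degree-r₂ (r₃ ∷ _) (r≢r₃ ∷ _) (r₂r₃ ∷ _) = 1<degree r≢r₃ (Adj-sym rr₂) r₂r₃

-- Spreading lists of natural numbers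

infix 3 _⇝_

-- xs ⇝ ys: up to order, ys arises from xs by moving pairs of entries
-- apart while keeping their sum.
data _⇝_ : List ℕ → List ℕ → Set where
  settle : xs ↭ ys → xs ⇝ ys
  spread : ∀ a s t → xs ↭ a + suc s ∷ a + suc t ∷ zs → a ∷ a + suc s + suc t ∷ zs ⇝ ys → xs ⇝ ys

⇝-respˡ-↭ : xs ↭ ys → ys ⇝ zs → xs ⇝ zs
⇝-respˡ-↭ p (settle q) = settle (↭-trans p q)
⇝-respˡ-↭ p (spread a s t q m) = spread a s t (↭-trans p q) m

⇝-trans : xs ⇝ ys → ys ⇝ zs → xs ⇝ zs
⇝-trans (settle p) m = ⇝-respˡ-↭ p m
⇝-trans (spread a s t p m) m′ = spread a s t p (⇝-trans m m′)

⇝-respʳ-↭ : xs ⇝ ys → ys ↭ zs → xs ⇝ zs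
⇝-respʳ-↭ m p = ⇝-trans m (settle p)

⇝-prep : ∀ x → xs ⇝ ys → x ∷ xs ⇝ x ∷ ys
⇝-prep x (settle p) = settle (prep x p)
⇝-prep x (spread a s t p m) = spread a s t
  (↭-trans (prep x p) (↭-sym (shift x (_ ∷ _ ∷ []) _)))
  (⇝-respˡ-↭ (shift x (_ ∷ _ ∷ []) _) (⇝-prep x m))

-- Unlike in `spread`, a shift may vanish here; the pair is then unchanged up to order.
⇝-pair : ∀ a s t → a + s ∷ a + t ∷ zs ⇝ a ∷ a + s + t ∷ zs
⇝-pair a zero t rewrite ℕ.+-identityʳ a = settle ↭-refl
⇝-pair a (suc s) zero rewrite ℕ.+-identityʳ a | ℕ.+-identityʳ (a + suc s) = settle (swap _ _ ↭-refl)
⇝-pair a (suc s) (suc t) = spread a s t ↭-refl (settle ↭-refl)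

-- The entries are absorbed one at a time, each leaving a 0 behind.
gather : ∀ x xs → x ∷ xs ⇝ x + sum xs ∷ replicate (length xs) 0
gather x [] rewrite ℕ.+-identityʳ x = settle ↭-refl
gather x (y ∷ ys) rewrite sym (ℕ.+-assoc x y (sum ys)) =
  ⇝-trans (⇝-pair 0 x y) (⇝-respʳ-↭ (⇝-prep 0 (gather (x + y) ys)) (swap _ _ ↭-refl))

replicate-∷ : ∀ {A : Set} q (x : A) ys → replicate q x ++ x ∷ ys ≡ x ∷ replicate q x ++ ys
replicate-∷ zero x ys = refl
replicate-∷ (suc q) x ys = cong (x ∷_) (replicate-∷ q x ys)

-- If `a` is what `r + x` has beyond `D` and `t` is what `x` lacks, then `r` exceeds `a` by `t`.
-- This brings `r` and `x` into the shape that `⇝-pair` expects.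
excess : ∀ x {D a r t} → D + a ≡ r + x → x + t ≡ D → a + t ≡ r
excess x {a = a} {r} {t} D+a≡r+x refl = ℕ.+-cancelʳ-≡ x _ _ (trans (arrange a t x) D+a≡r+x)
  where
  arrange : ∀ a t x → a + t + x ≡ x + t + a
  arrange = solve-∀

-- A greedy scan in which `r` is the one entry not yet settled. The next entry `x` is either merged
-- with it, leaving a 0, or the two are spread to `D` and the overflow, which becomes the new `r`.
compress : ∀ D r xs → r ≤ D → All (_≤ D) xs →
  ∃₂ λ q r′ → ∃[ z ] r′ ≤ D × q + z ≡ length xs × q * D + r′ ≡ r + sum xs ×
    (r ∷ xs ⇝ replicate q D ++ r′ ∷ replicate z 0)
compress D r [] r≤D [] = 0 , r , 0 , r≤D , refl , sym (ℕ.+-identityʳ r) , settle ↭-refl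
compress D r (x ∷ xs) r≤D (x≤D ∷ xs≤D) with ℕ.≤-total (r + x) D
... | inj₁ r+x≤D with compress D (r + x) xs r+x≤D xs≤D
...   | q , r′ , z , r′≤D , q+z≡ , sum≡ , m =
  q , r′ , suc z , r′≤D , trans (ℕ.+-suc q z) (cong suc q+z≡) , trans sum≡ (ℕ.+-assoc r x _) ,
  ⇝-trans (⇝-pair 0 r x) (⇝-respʳ-↭ (⇝-prep 0 m) (↭-sym (↭-trans
    (++⁺ˡ (replicate q D) (swap r′ 0 ↭-refl)) (shift 0 (replicate q D) (r′ ∷ replicate z 0)))))
compress D r (x ∷ xs) r≤D (x≤D ∷ xs≤D)
  | inj₂ D≤r+x with s , r+s≡D ← ℕ.m≤n⇒∃[o]m+o≡n r≤D | t , x+t≡D ← ℕ.m≤n⇒∃[o]m+o≡n x≤D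
                  | a , D+a≡r+x ← ℕ.m≤n⇒∃[o]m+o≡n D≤r+x
  with compress D a xs (ℕ.+-cancelˡ-≤ D _ _ (ℕ.≤-trans (ℕ.≤-reflexive D+a≡r+x) (ℕ.+-mono-≤ r≤D x≤D))) xs≤D
... | q , r′ , z , r′≤D , q+z≡ , sum≡ , m =
  suc q , r′ , z , r′≤D , cong suc q+z≡ , sum≡′ ,
  ⇝-trans (subst₂ _⇝_ before after (⇝-pair a t s)) (⇝-respˡ-↭ (swap _ _ ↭-refl) (⇝-prep D m))
  where
  open ≡-Reasoning
  sum≡′ : D + q * D + r′ ≡ r + (x + sum xs)
  sum≡′ = begin
    D + q * D + r′     ≡⟨ ℕ.+-assoc D _ _ ⟩
    D + (q * D + r′)   ≡⟨ cong (D +_) sum≡ ⟩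
    D + (a + sum xs)   ≡⟨ ℕ.+-assoc D a _ ⟨
    D + a + sum xs     ≡⟨ cong (_+ sum xs) D+a≡r+x ⟩
    r + x + sum xs     ≡⟨ ℕ.+-assoc r x _ ⟩
    r + (x + sum xs)   ∎
  a+t≡r : a + t ≡ r
  a+t≡r = excess x D+a≡r+x x+t≡D
  before : a + t ∷ a + s ∷ xs ≡ r ∷ x ∷ xs
  before = cong₂ (λ u v → u ∷ v ∷ xs) a+t≡r (excess r (trans D+a≡r+x (ℕ.+-comm r x)) r+s≡D)
  after : a ∷ a + t + s ∷ xs ≡ a ∷ D ∷ xs
  after = cong (λ u → a ∷ u ∷ xs) (trans (cong (_+ s) a+t≡r) r+s≡D)

-- Spreading the first pair from base 1 rather than 0 keeps a second positive entry, as the cycle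
-- demands.
gather-1 : ∀ x y xs → suc x ∷ suc y ∷ xs ⇝ suc (x + y + sum xs) ∷ 1 ∷ replicate (length xs) 0
gather-1 x y xs = ⇝-trans (⇝-pair 1 x y)
  (⇝-respʳ-↭ (⇝-prep 1 (gather (suc (x + y)) xs)) (swap _ _ ↭-refl))

-- Reaching the extremal sequences.

𝐳₁ : (n Δ : ℕ) → List ℕ
𝐳₁ n Δ = Δ ∷ n ∸ Δ + 1 ∷ 2 ∷ replicate (n ∸ 3) 1

𝐳₂ : (n Δ q : ℕ) → List ℕ
𝐳₂ n Δ q = replicate q Δ ++ n ∸ q * (Δ ∸ 1) + 1 ∷ replicate (n ∸ q ∸ 1) 1

𝐳≡𝐳₁ : ∀ n Δ 3≤Δ → FirstCase n Δ 3≤Δ → 𝐳 n Δ 3≤Δ ≡ 𝐳₁ n Δ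
𝐳≡𝐳₁ n Δ 3≤Δ first rewrite dec-true (firstCase? n Δ 3≤Δ) first = refl

𝐳≡𝐳₂ : ∀ n Δ 3≤Δ → ¬ FirstCase n Δ 3≤Δ → 𝐳 n Δ 3≤Δ ≡ 𝐳₂ n Δ (quotient n Δ 3≤Δ)
𝐳≡𝐳₂ n Δ 3≤Δ ¬first rewrite dec-false (firstCase? n Δ 3≤Δ) ¬first = refl

map-suc-sum : ∀ xs → sum (map suc xs) ≡ length xs + sum xs
map-suc-sum [] = refl
map-suc-sum (x ∷ xs) = cong suc (trans (cong (x +_) (map-suc-sum xs)) (arrange x (length xs) (sum xs)))
  where
  arrange : ∀ x k s → x + (k + s) ≡ k + (x + s)
  arrange = solve-∀

replicate-++-↘ : ∀ q {x y} → y ≤ x → Linked _≥_ (y ∷ ys) → Linked _≥_ (replicate q x ++ y ∷ ys)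
replicate-++-↘ zero _ l = l
replicate-++-↘ (suc zero) y≤x l = y≤x ∷ l
replicate-++-↘ (suc (suc q)) y≤x l = ℕ.≤-refl ∷ replicate-++-↘ (suc q) y≤x l

ones-↘ : ∀ z {x} → 1 ≤ x → Linked _≥_ (x ∷ replicate z 1)
ones-↘ zero _ = [-]
ones-↘ (suc z) 1≤x = 1≤x ∷ ones-↘ z ℕ.≤-refl

-- Degree sequences are written as map suc xs, so that spreading keeps all entries positive.

⇝-𝐳₁ : ∀ {n D x y} → xs ↭ D ∷ suc x ∷ suc y ∷ zs → length xs ≡ n → sum xs ≡ n → n ≤ suc D + D →
       ∃[ ys ] (xs ⇝ ys) × Linked _≥_ (map suc ys) × map suc ys ≡ 𝐳₁ n (suc D)
⇝-𝐳₁ {xs} {zs} {D = D} {x} {y} p refl sum≡ n≤ =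
  D ∷ suc (x + y + sum zs) ∷ 1 ∷ replicate (length zs) 0 ,
  ⇝-respˡ-↭ p (⇝-prep D (gather-1 x y zs)) ,
  -- The gathered excess is n - Δ; the bound n ≤ 2Δ - 1 keeps it at most `D`, so the list is
  -- non-increasing.
  s≤s (ℕ.+-cancelˡ-≤ (suc D) _ _ (ℕ.≤-trans (ℕ.≤-reflexive (trans (sym (arrange D x y (sum zs))) sum≡′)) n≤)) ∷
    s≤s (s≤s z≤n) ∷ subst (λ l → Linked _≥_ (2 ∷ l)) (sym (List.map-replicate suc (length zs) 0)) (ones-↘ _ (s≤s z≤n)) ,
  cong (suc D ∷_) (cong₂ (λ k l → k ∷ 2 ∷ l) second
    (trans (List.map-replicate suc (length zs) 0)
           (cong (λ l → replicate (l ∸ 3) 1) (sym (↭-length p)))))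
  where
  open ≡-Reasoning
  arrange : ∀ D x y s → D + (suc x + (suc y + s)) ≡ suc D + (suc (x + y + s))
  arrange = solve-∀
  sum≡′ : D + (suc x + (suc y + sum zs)) ≡ length xs
  sum≡′ = trans (sym (sum-↭ p)) sum≡
  second : suc (suc (x + y + sum zs)) ≡ length xs ∸ suc D + 1
  second = begin
    suc (suc (x + y + sum zs))                          ≡⟨ ℕ.+-comm 1 _ ⟩
    suc (x + y + sum zs) + 1                            ≡⟨ cong (_+ 1) (ℕ.m+n∸m≡n (suc D) _) ⟨
    suc D + suc (x + y + sum zs) ∸ suc D + 1            ≡⟨ cong (λ l → l ∸ suc D + 1) (arrange D x y (sum zs)) ⟨
    D + (suc x + (suc y + sum zs)) ∸ suc D + 1          ≡⟨ cong (λ l → l ∸ suc D + 1) sum≡′ ⟩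
    length xs ∸ suc D + 1                               ∎

division-unique : ∀ q r D .{{_ : NonZero D}} → r < D → (q * D + r) / D ≡ q
division-unique q r D r<D = begin
  (q * D + r) / D      ≡⟨ cong (_/ D) (ℕ.+-comm (q * D) r) ⟩
  (r + q * D) / D      ≡⟨ +-distrib-/-∣ʳ r (n∣m*n q) ⟩
  r / D + q * D / D    ≡⟨ cong₂ _+_ (m<n⇒m/n≡0 r<D) (m*n/n≡m q D) ⟩
  q                    ∎
  where open ≡-Reasoning

-- `compress` may stop with a remainder equal to `D`; counting that entry as full turns `r` into a
-- proper remainder modulo `D`.
compress-full : ∀ D x xs → 2 ≤ D → All (_≤ D) (x ∷ xs) → sum (x ∷ xs) ≡ length (x ∷ xs) →
  ∃₂ λ q r → ∃[ z ] r < D × q + suc z ≡ length (x ∷ xs) × q * D + r ≡ length (x ∷ xs) ×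
    (x ∷ xs ⇝ replicate q D ++ r ∷ replicate z 0)
compress-full D x xs 2≤D (x≤D ∷ xs≤D) sum≡ with compress D x xs x≤D xs≤D
... | q , r , z , r≤D , q+z≡ , sum′≡ , m with r ℕ.≟ D
...   | no r≢D = q , r , z , ℕ.≤∧≢⇒< r≤D r≢D , trans (ℕ.+-suc q z) (cong suc q+z≡) , trans sum′≡ sum≡ , m
...   | yes refl = full z q+z≡ m
  where
  full : ∀ z → q + z ≡ length xs → (x ∷ xs ⇝ replicate q r ++ r ∷ replicate z 0) → _
  -- With no zero left, all q + 1 entries would equal `D`, which is at least 2, and their sum would
  -- exceed their number.
  full zero q+0≡ m = ⊥-elim (ℕ.<⇒≢ (ℕ.m<m*n (suc q) r 2≤D) (begin
    suc q            ≡⟨ cong suc (ℕ.+-identityʳ q) ⟨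
    suc (q + 0)      ≡⟨ cong suc q+0≡ ⟩
    suc (length xs)  ≡⟨ trans sum′≡ sum≡ ⟨
    q * r + r        ≡⟨ ℕ.+-comm (q * r) r ⟩
    suc q * r        ∎))
    where open ≡-Reasoning
  -- The old remainder joins the full entries, and one of the zeros becomes the new remainder.
  full (suc z) q+z≡ m = suc q , 0 , z , ℕ.≤-trans (s≤s z≤n) 2≤D , cong suc q+z≡ ,
    trans (trans (ℕ.+-identityʳ _) (ℕ.+-comm r (q * r))) (trans sum′≡ sum≡) ,
    subst (x ∷ xs ⇝_) (replicate-∷ q r (replicate (suc z) 0)) m

-- As the sum is n, the compressed list reads n = qD + r with r < D, so the number of full entries
-- is the quotient n / D.
⇝-𝐳₂ : ∀ {n D} .{{_ : NonZero D}} → 2 ≤ D → 0 < n → All (_≤ D) xs → length xs ≡ n → sum xs ≡ n →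
       ∃[ ys ] (xs ⇝ ys) × Linked _≥_ (map suc ys) × map suc ys ≡ 𝐳₂ n (suc D) (n / D)
⇝-𝐳₂ {[]} _ () _ refl _
⇝-𝐳₂ {x ∷ xs} {D = D} 2≤D _ xs≤D refl sum≡ with compress-full D x xs 2≤D xs≤D sum≡
... | q , r , z , r<D , q+z≡ , sum′≡ , m =
  _ , m , subst (Linked _≥_) (sym degrees≡) (replicate-++-↘ q (ℕ.m≤n⇒m≤1+n r<D) (ones-↘ z (s≤s z≤n))) ,
  trans degrees≡ (begin
  replicate q (suc D) ++ suc r ∷ replicate z 1
    ≡⟨ cong₂ (λ k l → replicate q (suc D) ++ k ∷ replicate l 1) r≡ z≡ ⟩
  𝐳₂ (suc (length xs)) (suc D) q
    ≡⟨ cong (𝐳₂ (suc (length xs)) (suc D)) (trans (cong (_/ D) (sym sum′≡)) (division-unique q r D r<D)) ⟨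
  𝐳₂ (suc (length xs)) (suc D) (suc (length xs) / D) ∎)
  where
  open ≡-Reasoning
  degrees≡ : map suc (replicate q D ++ r ∷ replicate z 0) ≡ replicate q (suc D) ++ suc r ∷ replicate z 1
  degrees≡ = trans (List.map-++ suc (replicate q D) _)
    (cong₂ (λ k l → k ++ suc r ∷ l) (List.map-replicate suc q D) (List.map-replicate suc z 0))
  r≡ : suc r ≡ suc (length xs) ∸ q * D + 1
  r≡ = trans (ℕ.+-comm 1 r) (cong (_+ 1) (trans (sym (ℕ.m+n∸m≡n (q * D) r)) (cong (_∸ q * D) sum′≡)))
  z≡ : z ≡ suc (length xs) ∸ q ∸ 1
  z≡ = trans (cong (_∸ 1) (sym (ℕ.m+n∸m≡n q (suc z)))) (cong (λ l → l ∸ q ∸ 1) q+z≡)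

module _ {n : ℕ} (G : Graph n) where
  open Graph G using (degrees; degreeSequence)

  private
    ≥-order : DecTotalOrder _ _ _
    ≥-order = Flip.decTotalOrder ℕ.≤-decTotalOrder

  degrees↭degreeSequence : degrees ↭ degreeSequence
  degrees↭degreeSequence = ↭-sym (Sort.sort-↭ ≥-order degrees)

  degreeSequence-unique : degrees ↭ ys → Linked _≥_ ys → degreeSequence ≡ ys
  degreeSequence-unique p ys↘ = Pointwise.Pointwise-≡⇒≡ (↗↭↗⇒≋ (DecTotalOrder.totalOrder ≥-order)
    (Sort.sort-↗ ≥-order degrees) ys↘ (↭⇒↭ₛ (↭-trans (↭-sym degrees↭degreeSequence) p)))

-- Concavity

private
  exchange : ∀ s t k → s + (t + k) ≡ t + (s + k)
  exchange = solve-∀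

-- Order arithmetic without trichotomy.

module RealProperties {c ℓ₁ ℓ₂ : Level} (ℝ : RealNumbers c ℓ₁ ℓ₂) where

  open OverReals ℝ
  open RealNumbers ℝ using (commutativeRing; 0#; #⇔<⊎>; isStrictPartialOrder; _#_; #-cotrans; tight; #⇒invertible; invertible⇒#)
    renaming (_<_ to _<ᴿ_; -_ to -ᴿ_; _-_ to _-ᴿ_; +-monoˡ-< to +-monoˡ-<ᴿ; *-pos to *ᴿ-pos)
  module A = CommutativeRing commutativeRing
  open import Relation.Binary.Reasoning.Setoid A.setoid
  open import Algebra.Properties.Ring A.ring using (-‿distribˡ-*; -‿distribʳ-*; -‿involutive; -‿+-comm)
  open NaturalCoefficients A.commutativeSemiring using (solve; _:=_; _:+_; _:*_; con)
  open IsStrictPartialOrder isStrictPartialOrder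
    using () renaming (irrefl to <-irrefl; trans to <-trans; <-respˡ-≈ to <-respˡ; <-respʳ-≈ to <-respʳ)

  private
    variable
      x y z : Carrier

  x-y+y≈x : ∀ x y → x -ᴿ y +ᴿ y ≈ᴿ x
  x-y+y≈x x y = A.trans (A.+-assoc x _ y) (A.trans (A.+-congˡ (A.-‿inverseˡ y)) (A.+-identityʳ x))

  x+y-y≈x : ∀ x y → x +ᴿ y -ᴿ y ≈ᴿ x
  x+y-y≈x x y = A.trans (A.+-assoc x y _) (A.trans (A.+-congˡ (A.-‿inverseʳ y)) (A.+-identityʳ x))

  x-0≈x : ∀ x → x -ᴿ 0# ≈ᴿ x
  x-0≈x x = A.trans (A.sym (A.+-congʳ (A.+-identityʳ x))) (x+y-y≈x x 0#)

  -- Takes the place of trichotomy. It is cotransitivity of apartness, the reversed alternatives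
  -- being composed with `x < y`.
  <-cotrans : x <ᴿ y → ∀ z → x <ᴿ z ⊎ z <ᴿ y
  <-cotrans {x} {y} x<y z with #-cotrans (Equivalence.from (#⇔<⊎> x y) (inj₁ x<y)) z
  ... | inj₁ x#z = Sum.map₂ (λ z<x → <-trans z<x x<y) (Equivalence.to (#⇔<⊎> x z) x#z)
  ... | inj₂ z#y = [ inj₂ , (λ y<z → inj₁ (<-trans x<y y<z)) ]′ (Equivalence.to (#⇔<⊎> z y) z#y)

  <-≤-trans : x <ᴿ y → y ≤ᴿ z → x <ᴿ z
  <-≤-trans {z = z} x<y y≤z with <-cotrans x<y z
  ... | inj₁ x<z = x<z
  ... | inj₂ z<y = ⊥-elim (y≤z z<y)

  ≤-<-trans : x ≤ᴿ y → y <ᴿ z → x <ᴿ z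
  ≤-<-trans {x} x≤y y<z with <-cotrans y<z x
  ... | inj₁ y<x = ⊥-elim (x≤y y<x)
  ... | inj₂ x<z = x<z

  ≤-trans : x ≤ᴿ y → y ≤ᴿ z → x ≤ᴿ z
  ≤-trans x≤y y≤z z<x = x≤y (≤-<-trans y≤z z<x)

  <⇒≤ : x <ᴿ y → x ≤ᴿ y
  <⇒≤ x<y y<x = <-irrefl A.refl (<-trans x<y y<x)

  ≤-reflexive : x ≈ᴿ y → x ≤ᴿ y
  ≤-reflexive x≈y y<x = <-irrefl (A.sym x≈y) y<x

  ≤-resp : ∀ {x x′ y y′} → x ≈ᴿ x′ → y ≈ᴿ y′ → x ≤ᴿ y → x′ ≤ᴿ y′
  ≤-resp x≈x′ y≈y′ x≤y y′<x′ = x≤y (<-respˡ (A.sym y≈y′) (<-respʳ (A.sym x≈x′) y′<x′))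

  <-resp : ∀ {x x′ y y′} → x ≈ᴿ x′ → y ≈ᴿ y′ → x <ᴿ y → x′ <ᴿ y′
  <-resp x≈x′ y≈y′ = <-respˡ x≈x′ ∘ <-respʳ y≈y′

  +-monoʳ-< : ∀ z → x <ᴿ y → z +ᴿ x <ᴿ z +ᴿ y
  +-monoʳ-< z x<y = <-resp (A.+-comm _ z) (A.+-comm _ z) (+-monoˡ-<ᴿ z x<y)

  +-cancelʳ-< : ∀ z → x +ᴿ z <ᴿ y +ᴿ z → x <ᴿ y
  +-cancelʳ-< z x+z<y+z = <-resp (x+y-y≈x _ z) (x+y-y≈x _ z) (+-monoˡ-<ᴿ (-ᴿ z) x+z<y+z)

  +-cancelʳ-≤ : ∀ z → x +ᴿ z ≤ᴿ y +ᴿ z → x ≤ᴿ y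
  +-cancelʳ-≤ z x+z≤y+z y<x = x+z≤y+z (+-monoˡ-<ᴿ z y<x)

  +-monoˡ-≤ : ∀ z → x ≤ᴿ y → x +ᴿ z ≤ᴿ y +ᴿ z
  +-monoˡ-≤ z x≤y y+z<x+z = x≤y (+-cancelʳ-< z y+z<x+z)

  +-monoʳ-≤ : ∀ z → x ≤ᴿ y → z +ᴿ x ≤ᴿ z +ᴿ y
  +-monoʳ-≤ z x≤y = ≤-resp (A.+-comm _ z) (A.+-comm _ z) (+-monoˡ-≤ z x≤y)

  +-mono-≤ : ∀ {x y u v} → x ≤ᴿ y → u ≤ᴿ v → x +ᴿ u ≤ᴿ y +ᴿ v
  +-mono-≤ x≤y u≤v = ≤-trans (+-monoˡ-≤ _ x≤y) (+-monoʳ-≤ _ u≤v)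

  +-mono-<-≤ : ∀ {x y u v} → x <ᴿ y → u ≤ᴿ v → x +ᴿ u <ᴿ y +ᴿ v
  +-mono-<-≤ x<y u≤v = <-≤-trans (+-monoˡ-<ᴿ _ x<y) (+-monoʳ-≤ _ u≤v)

  +-mono-≤-< : ∀ {x y u v} → x ≤ᴿ y → u <ᴿ v → x +ᴿ u <ᴿ y +ᴿ v
  +-mono-≤-< x≤y u<v = ≤-<-trans (+-monoˡ-≤ _ x≤y) (+-monoʳ-< _ u<v)

  ≤∧≮⇒≈ : x ≤ᴿ y → ¬ x <ᴿ y → x ≈ᴿ y
  ≤∧≮⇒≈ {x} {y} x≤y ¬x<y = proj₁ (tight x y) ([ ¬x<y , x≤y ]′ ∘ Equivalence.to (#⇔<⊎> x y))

  square-pos : x # 0# → 0# <ᴿ x *ᴿ x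
  square-pos {x} x#0 with Equivalence.to (#⇔<⊎> x 0#) x#0
  ... | inj₂ 0<x = *ᴿ-pos 0<x 0<x
  ... | inj₁ x<0 = <-respʳ -x*-x≈x*x (*ᴿ-pos 0<-x 0<-x)
    where
    0<-x : 0# <ᴿ -ᴿ x
    0<-x = <-resp (A.-‿inverseʳ x) (A.+-identityˡ _) (+-monoˡ-<ᴿ (-ᴿ x) x<0)
    -x*-x≈x*x : -ᴿ x *ᴿ -ᴿ x ≈ᴿ x *ᴿ x
    -x*-x≈x*x = A.trans (A.sym (-‿distribˡ-* x _)) (A.trans (A.-‿cong (A.sym (-‿distribʳ-* x x))) (-‿involutive _))

  -- 1 is its own square, and it is apart from 0 because it is invertible.
  0<1 : 0# <ᴿ 1#
  0<1 = <-respʳ (A.*-identityˡ 1#) (square-pos (invertible⇒#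
    (1# , A.trans (A.*-identityˡ _) (x-0≈x 1#) , A.trans (A.*-identityʳ _) (x-0≈x 1#))))

  0≤fromℕ : ∀ k → 0# ≤ᴿ fromℕ k
  0≤fromℕ zero = ≤-reflexive A.refl
  0≤fromℕ (suc k) = ≤-resp (A.+-identityˡ 0#) A.refl (+-mono-≤ (<⇒≤ 0<1) (0≤fromℕ k))

  1≤fromℕ : ∀ k → 1# ≤ᴿ fromℕ (suc k)
  1≤fromℕ k = ≤-resp (A.+-identityʳ 1#) A.refl (+-monoʳ-≤ 1# (0≤fromℕ k))

  0<2 : 0# <ᴿ 1# +ᴿ 1#
  0<2 = <-trans 0<1 (<-respˡ (A.+-identityʳ 1#) (+-monoʳ-< 1# 0<1))

  halving : ∃[ h ] h +ᴿ h ≈ᴿ 1#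
  halving with #⇒invertible (Equivalence.from (#⇔<⊎> (1# +ᴿ 1#) 0#) (inj₂ 0<2))
  ... | h , h*2≈1 , _ = h , (begin
    h +ᴿ h                        ≈⟨ A.+-cong (A.*-identityʳ h) (A.*-identityʳ h) ⟨
    h *ᴿ 1# +ᴿ h *ᴿ 1#            ≈⟨ A.distribˡ h 1# 1# ⟨
    h *ᴿ (1# +ᴿ 1#)               ≈⟨ A.*-congˡ (x-0≈x _) ⟨
    h *ᴿ (1# +ᴿ 1# -ᴿ 0#)         ≈⟨ h*2≈1 ⟩
    1#                            ∎)

  ½ : Carrier
  ½ = proj₁ halving

  ½+½≈1 : ½ +ᴿ ½ ≈ᴿ 1#
  ½+½≈1 = proj₂ halving

  1-½≈½ : 1# -ᴿ ½ ≈ᴿ ½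
  1-½≈½ = A.trans (A.+-congʳ (A.sym ½+½≈1)) (x+y-y≈x ½ ½)

  0<½ : 0# <ᴿ ½
  0<½ with <-cotrans 0<1 ½
  ... | inj₁ 0<½ = 0<½
  -- Subtracting ½ from both sides of ½ < 1 leaves 0 < ½.
  ... | inj₂ ½<1 = <-resp (A.-‿inverseʳ ½) 1-½≈½ (+-monoˡ-<ᴿ (-ᴿ ½) ½<1)

  ½<1 : ½ <ᴿ 1#
  ½<1 = <-resp (A.+-identityʳ ½) ½+½≈1 (+-monoʳ-< ½ 0<½)

  -- The goal is a negation, so both factors may be taken positive under double negation: a
  -- non-negative factor that is not positive is 0, and so is the product.
  *-nonNeg : 0# ≤ᴿ x → 0# ≤ᴿ y → 0# ≤ᴿ x *ᴿ y
  *-nonNeg {x} {y} 0≤x 0≤y xy<0 = ¬¬0<x λ 0<x → ¬¬0<y λ 0<y → <⇒≤ (*ᴿ-pos 0<x 0<y) xy<0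
    where
    ¬¬0<x : ¬ ¬ 0# <ᴿ x
    ¬¬0<x 0≮x = <-irrefl (A.trans (A.*-congʳ (A.sym (≤∧≮⇒≈ 0≤x 0≮x))) (A.zeroˡ y)) xy<0
    ¬¬0<y : ¬ ¬ 0# <ᴿ y
    ¬¬0<y 0≮y = <-irrefl (A.trans (A.*-congˡ (A.sym (≤∧≮⇒≈ 0≤y 0≮y))) (A.zeroʳ x)) xy<0

  square-nonNeg : ∀ x → 0# ≤ᴿ x *ᴿ x
  square-nonNeg x xx<0 = <-irrefl (A.trans (A.*-congʳ x≈0) (A.zeroˡ x)) xx<0
    where
    x≈0 : x ≈ᴿ 0#
    x≈0 = proj₁ (tight x 0#) λ x#0 → <⇒≤ (square-pos x#0) xx<0

  private
    -x+x+y≈y : ∀ x y → -ᴿ x +ᴿ (x +ᴿ y) ≈ᴿ y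
    -x+x+y≈y x y = A.trans (A.sym (A.+-assoc _ x y)) (A.trans (A.+-congʳ (A.-‿inverseˡ x)) (A.+-identityˡ y))

  -‿anti-< : x <ᴿ y → -ᴿ y <ᴿ -ᴿ x
  -‿anti-< {x} {y} x<y = +-cancelʳ-< (x +ᴿ y) (<-resp
    (A.trans (A.sym (-x+x+y≈y y x)) (A.+-congˡ (A.+-comm y x))) (A.sym (-x+x+y≈y x y)) x<y)

  -‿anti-≤ : x ≤ᴿ y → -ᴿ y ≤ᴿ -ᴿ x
  -‿anti-≤ x≤y -x<-y = x≤y (<-resp (-‿involutive _) (-‿involutive _) (-‿anti-< -x<-y))

  private
    -- Both sides of the sum of a + w ≤ b + d and d + u ≤ w + v, with w + d split off.
    regroup : ∀ a w d u → (a +ᴿ w) +ᴿ (d +ᴿ u) ≈ᴿ (a +ᴿ u) +ᴿ (w +ᴿ d)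
    regroup = solve 4 (λ a w d u → (a :+ w) :+ (d :+ u) := (a :+ u) :+ (w :+ d)) A.refl

    regroup′ : ∀ b d w v → (b +ᴿ d) +ᴿ (w +ᴿ v) ≈ᴿ (b +ᴿ v) +ᴿ (w +ᴿ d)
    regroup′ = solve 4 (λ b d w v → (b :+ d) :+ (w :+ v) := (b :+ v) :+ (w :+ d)) A.refl

  -- Transitivity of a - b ≤ d - w ≤ v - u, written with sums only.
  chain-≤ : ∀ {a b d w u v} → a +ᴿ w ≤ᴿ b +ᴿ d → d +ᴿ u ≤ᴿ w +ᴿ v → a +ᴿ u ≤ᴿ b +ᴿ v
  chain-≤ p q = +-cancelʳ-≤ _ (≤-resp (regroup _ _ _ _) (regroup′ _ _ _ _) (+-mono-≤ p q))

  chain-<-≤ : ∀ {a b d w u v} → a +ᴿ w <ᴿ b +ᴿ d → d +ᴿ u ≤ᴿ w +ᴿ v → a +ᴿ u <ᴿ b +ᴿ v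
  chain-<-≤ p q = +-cancelʳ-< _ (<-resp (regroup _ _ _ _) (regroup′ _ _ _ _) (+-mono-<-≤ p q))

  chain-≤-< : ∀ {a b d w u v} → a +ᴿ w ≤ᴿ b +ᴿ d → d +ᴿ u <ᴿ w +ᴿ v → a +ᴿ u <ᴿ b +ᴿ v
  chain-≤-< p q = +-cancelʳ-< _ (<-resp (regroup _ _ _ _) (regroup′ _ _ _ _) (+-mono-≤-< p q))

  -- Concave sequences and spreading.

  Concaveℕ StrictlyConcaveℕ : (ℕ → Carrier) → Set _
  Concaveℕ h = ∀ k → h k +ᴿ h (2 + k) ≤ᴿ h (1 + k) +ᴿ h (1 + k)
  StrictlyConcaveℕ h = ∀ k → h k +ᴿ h (2 + k) <ᴿ h (1 + k) +ᴿ h (1 + k)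

  Σ[_] : (ℕ → Carrier) → List ℕ → Carrier
  Σ[ h ] []       = 0#
  Σ[ h ] (x ∷ xs) = h x +ᴿ Σ[ h ] xs

  Σ-↭ : ∀ h → xs ↭ ys → Σ[ h ] xs ≈ᴿ Σ[ h ] ys
  Σ-↭ h Permutation.refl = A.refl
  Σ-↭ h (prep x p) = A.+-congˡ (Σ-↭ h p)
  Σ-↭ h (swap x y p) = A.trans (A.+-congˡ (A.+-congˡ (Σ-↭ h p)))
    (solve 3 (λ a b s → a :+ (b :+ s) := b :+ (a :+ s)) A.refl (h x) (h y) _)
  Σ-↭ h (Permutation.trans p q) = A.trans (Σ-↭ h p) (Σ-↭ h q)

  Σ-map-suc : ∀ h xs → Σ[ h ] (map suc xs) ≡ Σ[ h ∘ suc ] xs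
  Σ-map-suc h [] = refl
  Σ-map-suc h (x ∷ xs) = cong (h (suc x) +ᴿ_) (Σ-map-suc h xs)

  Σ-++ : ∀ h xs ys → Σ[ h ] (xs ++ ys) ≈ᴿ Σ[ h ] xs +ᴿ Σ[ h ] ys
  Σ-++ h [] ys = A.sym (A.+-identityˡ _)
  Σ-++ h (x ∷ xs) ys = A.trans (A.+-congˡ (Σ-++ h xs ys)) (A.sym (A.+-assoc _ _ _))

  Σ-replicate : ∀ h k x → Σ[ h ] (replicate k x) ≈ᴿ fromℕ k *ᴿ h x
  Σ-replicate h zero x = A.sym (A.zeroˡ _)
  Σ-replicate h (suc k) x = A.sym (A.trans (A.distribʳ (h x) 1# (fromℕ k))
    (A.+-cong (A.*-identityˡ _) (A.sym (Σ-replicate h k x))))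

  private
    outer : ∀ (h : ℕ → Carrier) a s t → h a +ᴿ h (suc t + (suc s + a)) ≡ h a +ᴿ h (a + suc s + suc t)
    outer h a s t = cong (λ m → h a +ᴿ h m)
      (trans (ℕ.+-comm (suc t) (suc s + a)) (cong (_+ suc t) (ℕ.+-comm (suc s) a)))

    inner : ∀ (h : ℕ → Carrier) a s t → h (suc s + a) +ᴿ h (suc t + a) ≡ h (a + suc s) +ᴿ h (a + suc t)
    inner h a s t = cong₂ (λ m m′ → h m +ᴿ h m′) (ℕ.+-comm (suc s) a) (ℕ.+-comm (suc t) a)

  module _ {h : ℕ → Carrier} (h-concave : Concaveℕ h) where

    -- The increments of `h` decrease; the comparison of those at `k` and `s + k` passes through the
    -- one at `k + 1`.
    slopes-≤ : ∀ s k → h k +ᴿ h (suc (s + k)) ≤ᴿ h (suc k) +ᴿ h (s + k)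
    slopes-≤ zero k = ≤-reflexive (A.+-comm _ _)
    slopes-≤ (suc s) k = chain-≤ (h-concave k)
      (subst (λ m → h (suc k) +ᴿ h (suc m) ≤ᴿ h (2 + k) +ᴿ h m) (ℕ.+-suc s k) (slopes-≤ s (suc k)))

    -- The rises of `h` over `t` steps, starting at `k` and at `s + k`, are compared one step at a
    -- time.
    spread-≤ : ∀ s t k → h k +ᴿ h (t + (s + k)) ≤ᴿ h (s + k) +ᴿ h (t + k)
    spread-≤ s zero k = ≤-reflexive (A.+-comm _ _)
    spread-≤ s (suc t) k = chain-≤ (spread-≤ s t k) (slopes-≤′ s t k)
      where
      slopes-≤′ : ∀ s t k → h (t + k) +ᴿ h (suc (t + (s + k))) ≤ᴿ h (t + (s + k)) +ᴿ h (suc (t + k))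
      slopes-≤′ s t k = subst (λ m → h (t + k) +ᴿ h (suc m) ≤ᴿ h m +ᴿ h (suc (t + k)))
        (exchange s t k) (≤-resp A.refl (A.+-comm _ _) (slopes-≤ s (t + k)))

    module _ (h-strict : StrictlyConcaveℕ h) where

      slopes-< : ∀ s k → h k +ᴿ h (2 + s + k) <ᴿ h (suc k) +ᴿ h (suc s + k)
      slopes-< s k = chain-<-≤ (h-strict k)
        (subst (λ m → h (suc k) +ᴿ h (suc m) ≤ᴿ h (2 + k) +ᴿ h m) (ℕ.+-suc s k) (slopes-≤ s (suc k)))

      -- It suffices that the last of the t + 1 step comparisons is strict.
      spread-< : ∀ s t k → h k +ᴿ h (suc t + (suc s + k)) <ᴿ h (suc s + k) +ᴿ h (suc t + k)
      spread-< s t k = chain-≤-< (spread-≤ (suc s) t k)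
        (subst (λ m → h (t + k) +ᴿ h (suc m) <ᴿ h m +ᴿ h (suc (t + k)))
          (exchange (suc s) t k) (<-resp A.refl (A.+-comm _ _) (slopes-< s (t + k))))

    ⇝⇒Σ-≤ : xs ⇝ ys → Σ[ h ] ys ≤ᴿ Σ[ h ] xs
    ⇝⇒Σ-≤ (settle p) = ≤-reflexive (A.sym (Σ-↭ h p))
    ⇝⇒Σ-≤ (spread {zs = zs} a s t p m) = ≤-trans (⇝⇒Σ-≤ m) (≤-resp (A.+-assoc _ _ _)
      (A.trans (A.+-assoc _ _ _) (A.sym (Σ-↭ h p)))
      (+-monoˡ-≤ (Σ[ h ] zs) (subst₂ _≤ᴿ_ (outer h a s t) (inner h a s t) (spread-≤ (suc s) (suc t) a))))

    -- Every `spread` has positive shifts and so yields a strict drop. The alternatives are thus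
    -- read off the constructors, without deciding anything about real numbers.
    ⇝⇒Σ-<⊎↭ : StrictlyConcaveℕ h → xs ⇝ ys → xs ↭ ys ⊎ Σ[ h ] ys <ᴿ Σ[ h ] xs
    ⇝⇒Σ-<⊎↭ _ (settle p) = inj₁ p
    ⇝⇒Σ-<⊎↭ h-strict (spread {zs = zs} a s t p m) = inj₂ (≤-<-trans (⇝⇒Σ-≤ m) (<-resp (A.+-assoc _ _ _)
      (A.trans (A.+-assoc _ _ _) (A.sym (Σ-↭ h p)))
      (+-monoˡ-<ᴿ (Σ[ h ] zs) (subst₂ _<ᴿ_ (outer h a s t) (inner h a s t) (spread-< h-strict s t a)))))

  -- From concave functions to concave sequences.

  private
    midpoint : ∀ k → ½ *ᴿ fromℕ k +ᴿ (1# -ᴿ ½) *ᴿ fromℕ (2 + k) ≈ᴿ fromℕ (suc k)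
    midpoint k = begin
      ½ *ᴿ fromℕ k +ᴿ (1# -ᴿ ½) *ᴿ fromℕ (2 + k)  ≈⟨ A.+-congˡ (A.*-congʳ 1-½≈½) ⟩
      ½ *ᴿ fromℕ k +ᴿ ½ *ᴿ fromℕ (2 + k)
        ≈⟨ solve 2 (λ t x → t :* x :+ t :* (con 1 :+ (con 1 :+ x)) := (t :+ t) :* (con 1 :+ x)) A.refl ½ (fromℕ k) ⟩
      (½ +ᴿ ½) *ᴿ fromℕ (suc k)                   ≈⟨ A.*-congʳ ½+½≈1 ⟩
      1# *ᴿ fromℕ (suc k)                         ≈⟨ A.*-identityˡ _ ⟩
      fromℕ (suc k)                               ∎

    mean : ∀ x y → (½ *ᴿ x +ᴿ (1# -ᴿ ½) *ᴿ y) +ᴿ (½ *ᴿ x +ᴿ (1# -ᴿ ½) *ᴿ y) ≈ᴿ x +ᴿ y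
    mean x y = begin
      (½ *ᴿ x +ᴿ (1# -ᴿ ½) *ᴿ y) +ᴿ (½ *ᴿ x +ᴿ (1# -ᴿ ½) *ᴿ y)
        ≈⟨ A.+-cong (A.+-congˡ (A.*-congʳ 1-½≈½)) (A.+-congˡ (A.*-congʳ 1-½≈½)) ⟩
      (½ *ᴿ x +ᴿ ½ *ᴿ y) +ᴿ (½ *ᴿ x +ᴿ ½ *ᴿ y)
        ≈⟨ solve 3 (λ t x y → (t :* x :+ t :* y) :+ (t :* x :+ t :* y) := (t :+ t) :* (x :+ y)) A.refl ½ x y ⟩
      (½ +ᴿ ½) *ᴿ (x +ᴿ y)  ≈⟨ A.*-congʳ ½+½≈1 ⟩
      1# *ᴿ (x +ᴿ y)        ≈⟨ A.*-identityˡ _ ⟩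
      x +ᴿ y                ∎

    1≤midpoint : ∀ k → 1# ≤ᴿ ½ *ᴿ fromℕ (suc k) +ᴿ (1# -ᴿ ½) *ᴿ fromℕ (3 + k)
    1≤midpoint k = ≤-resp A.refl (A.sym (midpoint (suc k))) (1≤fromℕ (suc k))

  module _ {f : Carrier → Carrier} where

    private
      F : ℕ → Carrier
      F = f ∘ fromℕ

    -- The midpoint inequality between k + 1 and k + 3, doubled to clear the factor ½. The shift by
    -- `suc` keeps all arguments in [1,∞).
    concave⇒Concaveℕ : IsConcave f → Concaveℕ (F ∘ suc)
    concave⇒Concaveℕ f-concave k = ≤-resp (mean _ _) (A.+-cong at-mid at-mid) (+-mono-≤ half half)
      where
      open IsConcave f-concave renaming (cong to f-cong)
      half = concave (fromℕ (suc k)) (fromℕ (3 + k)) ½ (1≤fromℕ k) (1≤fromℕ (2 + k)) (<⇒≤ 0<½) (<⇒≤ ½<1)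
      at-mid = f-cong (1≤midpoint k) (1≤fromℕ (suc k)) (midpoint (suc k))

    strictlyConcave⇒StrictlyConcaveℕ : IsStrictlyConcave f → StrictlyConcaveℕ (F ∘ suc)
    strictlyConcave⇒StrictlyConcaveℕ f-strict k =
      <-resp (mean _ _) (A.+-cong at-mid at-mid) (+-mono-<-≤ half (<⇒≤ half))
      where
      open IsStrictlyConcave f-strict
      k+1<k+3 : fromℕ (suc k) <ᴿ fromℕ (3 + k)
      k+1<k+3 = <-resp (A.+-identityˡ _) (A.+-assoc 1# 1# _) (+-monoˡ-<ᴿ (fromℕ (suc k)) 0<2)
      half = strict (fromℕ (suc k)) (fromℕ (3 + k)) ½ (1≤fromℕ k) (1≤fromℕ (2 + k))
        (Equivalence.from (#⇔<⊎> _ _) (inj₁ k+1<k+3)) 0<½ ½<1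
      at-mid = IsConcave.cong isConcave (1≤midpoint k) (1≤fromℕ (suc k)) (midpoint (suc k))

    F[1] : IsConcave f → F 1 ≈ᴿ f 1#
    F[1] f-concave = IsConcave.cong f-concave (1≤fromℕ 0) (≤-reflexive A.refl) (A.+-identityʳ 1#)

  -- The strictly concave function -x².

  negSquare : Carrier → Carrier
  negSquare x = -ᴿ (x *ᴿ x)

  private
    -- A closed form of the Jensen gap of the square; its sign settles both concavity and
    -- strictness.
    jensen-gap : ∀ x y t → t *ᴿ (x *ᴿ x) +ᴿ (1# -ᴿ t) *ᴿ (y *ᴿ y) ≈ᴿ
      (t *ᴿ x +ᴿ (1# -ᴿ t) *ᴿ y) *ᴿ (t *ᴿ x +ᴿ (1# -ᴿ t) *ᴿ y) +ᴿ
      t *ᴿ (1# -ᴿ t) *ᴿ ((y -ᴿ x) *ᴿ (y -ᴿ x))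
    jensen-gap x y t = begin
      t *ᴿ (x *ᴿ x) +ᴿ u *ᴿ (y *ᴿ y)
        ≈⟨ A.+-congˡ (A.*-congˡ (A.*-cong y≈ y≈)) ⟩
      t *ᴿ (x *ᴿ x) +ᴿ u *ᴿ ((d +ᴿ x) *ᴿ (d +ᴿ x))
        ≈⟨ A.*-identityˡ _ ⟨
      1# *ᴿ (t *ᴿ (x *ᴿ x) +ᴿ u *ᴿ ((d +ᴿ x) *ᴿ (d +ᴿ x)))
        -- The factor u + t, which is 1, makes both sides quadratic in `t` and `u`; the identity
        -- then holds in every commutative semiring.
        ≈⟨ A.*-congʳ (x-y+y≈x 1# t) ⟨
      (u +ᴿ t) *ᴿ (t *ᴿ (x *ᴿ x) +ᴿ u *ᴿ ((d +ᴿ x) *ᴿ (d +ᴿ x)))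
        ≈⟨ solve 4 (λ t u x d → (u :+ t) :* (t :* (x :* x) :+ u :* ((d :+ x) :* (d :+ x))) :=
             (t :* x :+ u :* (d :+ x)) :* (t :* x :+ u :* (d :+ x)) :+ t :* u :* (d :* d)) A.refl t u x d ⟩
      (t *ᴿ x +ᴿ u *ᴿ (d +ᴿ x)) *ᴿ (t *ᴿ x +ᴿ u *ᴿ (d +ᴿ x)) +ᴿ t *ᴿ u *ᴿ (d *ᴿ d)
        ≈⟨ A.+-congʳ (A.*-cong z≈ z≈) ⟨
      (t *ᴿ x +ᴿ u *ᴿ y) *ᴿ (t *ᴿ x +ᴿ u *ᴿ y) +ᴿ t *ᴿ u *ᴿ (d *ᴿ d) ∎
      where
      u d : Carrier
      u = 1# -ᴿ t
      d = y -ᴿ x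
      y≈ : y ≈ᴿ d +ᴿ x
      y≈ = A.sym (x-y+y≈x y x)
      z≈ : t *ᴿ x +ᴿ u *ᴿ y ≈ᴿ t *ᴿ x +ᴿ u *ᴿ (d +ᴿ x)
      z≈ = A.+-congˡ (A.*-congˡ y≈)

    pull-neg : ∀ t u x y → -ᴿ (t *ᴿ x +ᴿ u *ᴿ y) ≈ᴿ t *ᴿ -ᴿ x +ᴿ u *ᴿ -ᴿ y
    pull-neg t u x y = A.trans (A.sym (-‿+-comm _ _)) (A.+-cong (-‿distribʳ-* t x) (-‿distribʳ-* u y))

    x≤y⇒0≤y-x : x ≤ᴿ y → 0# ≤ᴿ y -ᴿ x
    x≤y⇒0≤y-x {x} x≤y = ≤-resp (A.-‿inverseʳ x) A.refl (+-monoˡ-≤ (-ᴿ x) x≤y)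

    x<y⇒0<y-x : x <ᴿ y → 0# <ᴿ y -ᴿ x
    x<y⇒0<y-x {x} x<y = <-resp (A.-‿inverseʳ x) A.refl (+-monoˡ-<ᴿ (-ᴿ x) x<y)

    x#y⇒y-x#0 : x # y → (y -ᴿ x) # 0#
    x#y⇒y-x#0 {x} {y} x#y with Equivalence.to (#⇔<⊎> x y) x#y
    ... | inj₁ x<y = Equivalence.from (#⇔<⊎> _ _) (inj₂ (x<y⇒0<y-x x<y))
    ... | inj₂ y<x = Equivalence.from (#⇔<⊎> _ _)
      (inj₁ (<-resp A.refl (A.-‿inverseʳ x) (+-monoˡ-<ᴿ (-ᴿ x) y<x)))

  -- Supplies a strictly concave function in every model of ℝ, so that equality for all concave
  -- functions determines the degree sequence.
  negSquare-isStrictlyConcave : IsStrictlyConcave negSquare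
  negSquare-isStrictlyConcave = record
    { isConcave = record
      { cong = λ _ _ x≈y → A.-‿cong (A.*-cong x≈y x≈y)
      ; concave = λ x y t _ _ 0≤t t≤1 → ≤-resp (pull-neg _ _ _ _) A.refl (-‿anti-≤
          (≤-resp (A.+-identityʳ _) (A.sym (jensen-gap x y t))
            (+-monoʳ-≤ _ (*-nonNeg (*-nonNeg 0≤t (x≤y⇒0≤y-x t≤1)) (square-nonNeg _)))))
      }
    ; strict = λ x y t _ _ x#y 0<t t<1 → <-resp (pull-neg _ _ _ _) A.refl (-‿anti-<
        (<-resp (A.+-identityʳ _) (A.sym (jensen-gap x y t))
          (+-monoʳ-< _ (*ᴿ-pos (*ᴿ-pos 0<t (x<y⇒0<y-x t<1)) (square-pos (x#y⇒y-x#0 x#y))))))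
    }

  -- The index and the bounds as sums over lists.

  I≡Σ : ∀ {n} f (G : Graph n) → I f G ≡ Σ[ f ∘ fromℕ ] (Graph.degrees G)
  I≡Σ {n} f G = go id
    where
    open Graph G using (degree)
    -- `g` is arbitrary so that the induction can pass to `g ∘ Fin.suc`.
    go : ∀ {m} (g : Fin m → Fin n) →
         RealNumbers.sum ℝ (λ i → f (fromℕ (degree (g i)))) ≡ Σ[ f ∘ fromℕ ] (map degree (tabulate g))
    go {zero} g = refl
    go {suc m} g = cong (f (fromℕ (degree (g Fin.zero))) +ᴿ_) (go (g ∘ Fin.suc))

  bound₁≈Σ : ∀ n Δ {f} → IsConcave f →
    f (fromℕ Δ) +ᴿ f (fromℕ (n ∸ Δ + 1)) +ᴿ f (fromℕ 2) +ᴿ fromℕ (n ∸ 3) *ᴿ f 1# ≈ᴿ Σ[ f ∘ fromℕ ] (𝐳₁ n Δ)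
  bound₁≈Σ n Δ {f} f-concave = A.trans (A.+-assoc _ _ _) (A.trans (A.+-assoc _ _ _)
    (A.+-congˡ (A.+-congˡ (A.+-congˡ (A.trans (A.*-congˡ (A.sym (F[1] f-concave)))
      (A.sym (Σ-replicate (f ∘ fromℕ) (n ∸ 3) 1)))))))

  bound₂≈Σ : ∀ n Δ q {f} → IsConcave f →
    fromℕ q *ᴿ f (fromℕ Δ) +ᴿ f (fromℕ (n ∸ q * (Δ ∸ 1) + 1)) +ᴿ fromℕ (n ∸ q ∸ 1) *ᴿ f 1# ≈ᴿ
    Σ[ f ∘ fromℕ ] (𝐳₂ n Δ q)
  bound₂≈Σ n Δ q {f} f-concave = A.trans (A.+-assoc _ _ _) (A.trans
    (A.+-cong (A.sym (Σ-replicate (f ∘ fromℕ) q Δ)) (A.+-congˡ (A.trans (A.*-congˡ (A.sym (F[1] f-concave)))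
      (A.sym (Σ-replicate (f ∘ fromℕ) (n ∸ q ∸ 1) 1)))))
    (A.sym (Σ-++ (f ∘ fromℕ) (replicate q Δ) _)))

-- The excesses of a unicyclic graph.

module _ {n : ℕ} (G : Graph n) (unicyclic : Graph.Unicyclic G) where
  open Graph G using (degree; degrees; maxDegree)

  excesses : List ℕ
  excesses = map (pred ∘ degree) (allFin n)

  degrees≡suc-excesses : degrees ≡ map suc excesses
  degrees≡suc-excesses = trans
    (List.map-cong (λ u → sym (ℕ.suc-pred (degree u) {{>-nonZero (0<degree G unicyclic u)}})) (allFin n))
    (List.map-∘ (allFin n))

  length-excesses : length excesses ≡ n
  length-excesses = trans (List.length-map _ (allFin n)) (List.length-tabulate {n = n} id)

  sum-excesses : sum excesses ≡ n
  sum-excesses = ℕ.+-cancelˡ-≡ n _ _ (begin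
    n + sum excesses                 ≡⟨ cong (_+ sum excesses) length-excesses ⟨
    length excesses + sum excesses   ≡⟨ map-suc-sum excesses ⟨
    sum (map suc excesses)           ≡⟨ cong sum degrees≡suc-excesses ⟨
    sum degrees                      ≡⟨ sum-degrees G unicyclic ⟩
    n + n                            ∎)
    where open ≡-Reasoning

  module _ {D : ℕ} (maxDegree≡ : maxDegree ≡ suc D) where

    excesses-bounded : All (_≤ D) excesses
    excesses-bounded = All.map ℕ.≤-pred
      (All.map⁻ (subst (All (_≤ suc D)) degrees≡suc-excesses
        (subst (λ m → All (_≤ m) degrees) maxDegree≡ (Extrema.xs≤max 0 degrees))))

    maxDegreeVertex : ∃[ u ] degree u ≡ suc D
    maxDegreeVertex with Extrema.argmax-sel id 0 degrees
    -- The maximum could be the default 0 of `max`, which is not of the form `suc D`.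
    ... | inj₁ max≡0 with () ← trans (sym maxDegree≡) max≡0
    ... | inj₂ max∈ with ∈-map⁻ degree max∈
    ...   | u , _ , max≡ = u , trans (sym max≡) maxDegree≡

    private
      -- At most one of the three branching vertices on the cycle equals `m`, so two others remain.
      avoiding : ∀ m → ∃₂ λ a b → Unique (m ∷ a ∷ b ∷ []) × 1 < degree a × 1 < degree b
      avoiding m with threeBranching G (proj₁ (proj₂ unicyclic))
      ... | a ∷ b ∷ c ∷ [] , refl , (a≢b ∷ a≢c ∷ []) ∷ (b≢c ∷ []) ∷ [] ∷ [] , 1<a ∷ 1<b ∷ 1<c ∷ []
        with m Fin.≟ a | m Fin.≟ b
      ... | yes refl | _ = b , c , (a≢b ∷ a≢c ∷ []) ∷ (b≢c ∷ []) ∷ [] ∷ [] , 1<b , 1<c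
      ... | no m≢a | yes refl = a , c , (m≢a ∷ b≢c ∷ []) ∷ (a≢c ∷ []) ∷ [] ∷ [] , 1<a , 1<c
      ... | no m≢a | no m≢b = a , b , (m≢a ∷ m≢b ∷ []) ∷ (a≢b ∷ []) ∷ [] ∷ [] , 1<a , 1<b

      extract : ∀ {m a b : Fin n} → Unique (m ∷ a ∷ b ∷ []) → ∃[ us ] allFin n ↭ m ∷ a ∷ b ∷ us
      extract {m} {a} {b} ((m≢a ∷ m≢b ∷ []) ∷ (a≢b ∷ []) ∷ _)
        with us₁ , p₁ ← ∈⇒↭ (∈-allFin m)
        with us₂ , p₂ ← ∈⇒↭ (∈-tail (∈-resp-↭ p₁ (∈-allFin a)) (m≢a ∘ sym))
        with us₃ , p₃ ← ∈⇒↭ (∈-tail (∈-resp-↭ p₂ (∈-tail (∈-resp-↭ p₁ (∈-allFin b)) (m≢b ∘ sym))) (a≢b ∘ sym))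
        = us₃ , ↭-trans p₁ (prep m (↭-trans p₂ (prep a p₃)))

      pred-pred : ∀ {k} → 1 < k → ∃[ x ] pred k ≡ suc x
      pred-pred (s≤s (s≤s {n = x} _)) = x , refl

    excesses↭ : ∃₂ λ x y → ∃[ zs ] excesses ↭ D ∷ suc x ∷ suc y ∷ zs
    excesses↭
      with m , m≡ ← maxDegreeVertex
      with a , b , uniq , 1<a , 1<b ← avoiding m
      with us , p ← extract uniq
      with x , a≡ ← pred-pred 1<a
      with y , b≡ ← pred-pred 1<b
      = x , y , map (pred ∘ degree) us , ↭-trans (map⁺ (pred ∘ degree) p)
          (↭-reflexive (cong₂ _∷_ (cong pred m≡) (cong₂ _∷_ a≡ (cong₂ _∷_ b≡ refl))))

-- As D = Δ - 1, the second alternative is n = 2D, while quotient 1 gives n = D + n % D with n % D <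
-- D.
firstCase⇒≤ : ∀ n D 3≤Δ → FirstCase n (suc D) 3≤Δ → n ≤ suc D + D
firstCase⇒≤ n D 3≤Δ (inj₂ refl) = ℕ.m≤n⇒m≤1+n (ℕ.≤-reflexive
  (trans (cong (_∸ 1) (ℕ.+-suc D (D + 0))) (cong (D +_) (ℕ.+-identityʳ D))))
firstCase⇒≤ n D 3≤Δ (inj₁ n/D≡1) = begin
  n                        ≡⟨ m≡m%n+[m/n]*n n D ⟩
  n % D + n / D * D        ≡⟨ cong (λ q → n % D + q * D) n/D≡1 ⟩
  n % D + 1 * D            ≡⟨ cong (n % D +_) (ℕ.*-identityˡ D) ⟩
  n % D + D                ≤⟨ ℕ.+-monoˡ-≤ D (ℕ.m≤n⇒m≤1+n (ℕ.<⇒≤ (m%n<n n D))) ⟩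
  suc D + D                ∎
  where
  open ℕ.≤-Reasoning
  instance _ = >-nonZero (ℕ.m<n⇒0<n∸m (ℕ.≤-trans (ℕ.n≤1+n 2) 3≤Δ))

-- The bounds and their equality cases.

module _ {c ℓ₁ ℓ₂ : Level} (ℝ : RealNumbers c ℓ₁ ℓ₂) where
  open OverReals ℝ
  open RealProperties ℝ

  -- Both cases end alike once the excesses are spread to the target `ys`: the chain of moves gives
  -- the inequality, and a strictly concave function attains it only if the chain is a mere
  -- permutation.
  extremal : ∀ {n} Δ 3≤Δ (G : Graph n) (unicyclic : Graph.Unicyclic G) {ys : List ℕ} →
    excesses G unicyclic ⇝ ys → Linked _≥_ (map suc ys) → map suc ys ≡ 𝐳 n Δ 3≤Δ →
    (bound : (Carrier → Carrier) → Carrier) →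
    (∀ {f} → IsConcave f → bound f ≈ᴿ Σ[ f ∘ fromℕ ] (map suc ys)) →
    (∀ f → IsConcave f → bound f ≤ᴿ I f G)
    × ((∀ f → IsConcave f → I f G ≈ᴿ bound f) ⇔ 𝒦 n Δ 3≤Δ G)
    × (∀ f → IsStrictlyConcave f → (I f G ≈ᴿ bound f ⇔ 𝒦 n Δ 3≤Δ G))
  extremal {n} Δ 3≤Δ G unicyclic {ys} es⇝ys ys↘ ys≡𝐳 bound bound≈Σ =
    -- Equality for all concave functions is tested on -x².
    lower , mk⇔ (λ eq → eq⇒𝒦 negSquare-isStrictlyConcave (eq _ isConcave)) 𝒦⇒eq ,
    λ f f-strict → mk⇔ (eq⇒𝒦 f-strict) (λ k → 𝒦⇒eq k f (IsStrictlyConcave.isConcave f-strict))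
    where
    open Graph G using (degrees)
    open IsStrictlyConcave negSquare-isStrictlyConcave using (isConcave)
    es : List ℕ
    es = excesses G unicyclic

    I≈Σ : ∀ f → I f G ≈ᴿ Σ[ f ∘ fromℕ ∘ suc ] es
    I≈Σ f = A.reflexive (trans (I≡Σ f G)
      (trans (cong Σ[ f ∘ fromℕ ] (degrees≡suc-excesses G unicyclic)) (Σ-map-suc (f ∘ fromℕ) es)))

    bound≈ : ∀ {f} → IsConcave f → bound f ≈ᴿ Σ[ f ∘ fromℕ ∘ suc ] ys
    bound≈ f-concave = A.trans (bound≈Σ f-concave) (A.reflexive (Σ-map-suc _ ys))

    lower : ∀ f → IsConcave f → bound f ≤ᴿ I f G
    lower f f-concave = ≤-resp (A.sym (bound≈ f-concave)) (A.sym (I≈Σ f))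
      (⇝⇒Σ-≤ (concave⇒Concaveℕ f-concave) es⇝ys)

    𝒦⇒eq : 𝒦 n Δ 3≤Δ G → ∀ f → IsConcave f → I f G ≈ᴿ bound f
    𝒦⇒eq (_ , sequence≡) f f-concave = A.trans (A.reflexive (I≡Σ f G)) (A.trans
      (Σ-↭ (f ∘ fromℕ) (↭-trans (degrees↭degreeSequence G)
        (↭-reflexive (trans sequence≡ (sym ys≡𝐳)))))
      (A.sym (bound≈Σ f-concave)))

    degreeSequence≡ : es ↭ ys → Graph.degreeSequence G ≡ 𝐳 n Δ 3≤Δ
    degreeSequence≡ es↭ys = trans (degreeSequence-unique G degrees↭ ys↘) ys≡𝐳
      where
      degrees↭ : degrees ↭ map suc ys
      degrees↭ = ↭-trans (↭-reflexive (degrees≡suc-excesses G unicyclic)) (map⁺ suc es↭ys)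

    eq⇒𝒦 : ∀ {f} → IsStrictlyConcave f → I f G ≈ᴿ bound f → 𝒦 n Δ 3≤Δ G
    -- Equality excludes a strict drop, so the excesses already are the target up to order.
    eq⇒𝒦 {f} f-strict eq = unicyclic , degreeSequence≡
      ([ id , (λ Σys<Σes → ⊥-elim (Σes≤Σys Σys<Σes)) ]′
        (⇝⇒Σ-<⊎↭ (concave⇒Concaveℕ f-concave) (strictlyConcave⇒StrictlyConcaveℕ f-strict) es⇝ys))
      where
      f-concave : IsConcave f
      f-concave = IsStrictlyConcave.isConcave f-strict
      Σes≤Σys : Σ[ f ∘ fromℕ ∘ suc ] es ≤ᴿ Σ[ f ∘ fromℕ ∘ suc ] ys
      Σes≤Σys = ≤-reflexive (A.trans (A.sym (I≈Σ f)) (A.trans eq (bound≈ f-concave)))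

theorem4p6 :
  ∀ {c ℓ₁ ℓ₂ : Level} (ℝ : RealNumbers c ℓ₁ ℓ₂)
  (n Δ : ℕ) → 4 ≤ n → (3≤Δ : 3 ≤ Δ) →
  (G : Graph n) → Graph.Unicyclic G → Graph.maxDegree G ≡ Δ →
  let open OverReals ℝ
      q : ℕ
      q = quotient n Δ 3≤Δ
      bound₁ : (Carrier → Carrier) → Carrier
      bound₁ f = f (fromℕ Δ) +ᴿ f (fromℕ (n ∸ Δ + 1)) +ᴿ f (fromℕ 2) +ᴿ fromℕ (n ∸ 3) *ᴿ f 1#
      bound₂ : (Carrier → Carrier) → Carrier
      bound₂ f = fromℕ q *ᴿ f (fromℕ Δ) +ᴿ f (fromℕ (n ∸ q * (Δ ∸ 1) + 1)) +ᴿ fromℕ (n ∸ q ∸ 1) *ᴿ f 1#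
  in
  (q ≡ 1 ⊎ n ≡ 2 * Δ ∸ 2 →
    (∀ f → IsConcave f → bound₁ f ≤ᴿ I f G)
    × ((∀ f → IsConcave f → I f G ≈ᴿ bound₁ f) ⇔ 𝒦 n Δ 3≤Δ G)
    × (∀ f → IsStrictlyConcave f → (I f G ≈ᴿ bound₁ f ⇔ 𝒦 n Δ 3≤Δ G)))
  ×
  (q > 1 × n ≢ 2 * Δ ∸ 2 →
    (∀ f → IsConcave f → bound₂ f ≤ᴿ I f G)
    × ((∀ f → IsConcave f → I f G ≈ᴿ bound₂ f) ⇔ 𝒦 n Δ 3≤Δ G)
    × (∀ f → IsStrictlyConcave f → (I f G ≈ᴿ bound₂ f ⇔ 𝒦 n Δ 3≤Δ G)))
theorem4p6 ℝ n (suc D) 4≤n 3≤Δ@(s≤s 2≤D) G unicyclic maxDegree≡ = first , second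
  where
  open RealProperties ℝ
  first : FirstCase n (suc D) 3≤Δ → _
  first firstCase
    with x , y , zs , p ← excesses↭ G unicyclic maxDegree≡
    with ys , es⇝ys , ys↘ , ys≡𝐳₁ ← ⇝-𝐳₁ p (length-excesses G unicyclic) (sum-excesses G unicyclic)
                                         (firstCase⇒≤ n D 3≤Δ firstCase) =
    extremal ℝ (suc D) 3≤Δ G unicyclic es⇝ys ys↘ (trans ys≡𝐳₁ (sym (𝐳≡𝐳₁ n (suc D) 3≤Δ firstCase))) _
      (λ {f} f-concave → A.trans (bound₁≈Σ n (suc D) f-concave)
        (A.reflexive (cong Σ[ _ ] (sym ys≡𝐳₁))))

  second : _ → _
  second (q>1 , n≢)
    -- The instance is spelled as inside `quotient`, so that the quotient delivered here is `q`
    -- itself.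
    with ys , es⇝ys , ys↘ , ys≡𝐳₂ ← ⇝-𝐳₂ {{>-nonZero (ℕ.m<n⇒0<n∸m (ℕ.≤-trans (ℕ.n≤1+n 2) 3≤Δ))}}
                                         2≤D (ℕ.≤-trans (s≤s z≤n) 4≤n) (excesses-bounded G unicyclic maxDegree≡)
                                         (length-excesses G unicyclic) (sum-excesses G unicyclic) =
    extremal ℝ (suc D) 3≤Δ G unicyclic es⇝ys ys↘
      (trans ys≡𝐳₂ (sym (𝐳≡𝐳₂ n (suc D) 3≤Δ [ (λ q≡1 → ℕ.<⇒≢ q>1 (sym q≡1)) , n≢ ]′))) _
      (λ {f} f-concave → A.trans (bound₂≈Σ n (suc D) (quotient n (suc D) 3≤Δ) f-concave)
        (A.reflexive (cong Σ[ _ ] (sym ys≡𝐳₂))))
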